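{- Let $F(n)=\#\{(x,y)\in\mathbb{Z}^2 : x^2+2y^2\le n\}$ be the number of lattice points contained in the elliptical region $x^2+2y^2\le n$. Then $F(0)=1$, $F(1)=3$, $F(2)=5$, $F(5)=11$, and for all $n\in\mathbb{N}$ with $n\ne 1,2,5$, $$F(n) = 1+2\,\mathcal{N}_{\lceil n/4\rceil,\,3/4,\,\{ -n/4\},\,1,\,2}+2\,\mathcal{N}_{\lceil n/4\rceil,\,1/4,\,\{ -n/4\},\,1,\,2}+2n+2\left\lfloor\frac{n}{3}\right\rfloor-4\left\lceil\frac{n}{4}\right\rceil.$$
   Context: $\mathbb{N}$ denotes the set of positive integers; $\lfloor\cdot\rfloor$ and $\lceil\cdot\rceil$ are the floor and ceiling functions, and $\{x\}=x-\lfloor x\rfloor$ is the fractional part of $x\in\mathbb{R}$. For $n,m\in\mathbb{N}$, $r\in\mathbb{Z}$ and $\alpha,\nu\in\mathbb{R}$, define $$\mathcal{N}_{n,\alpha,\nu,r,m}=\#\left\{k\in\mathbb{Z} : 1\le k\le n,\ \left\lfloor\frac{n-\nu}{k}+\alpha\right\rfloor\equiv r \pmod m\right\}.$$ -}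

module Defs where

open import Data.Nat.Base as ℕ using (ℕ; zero; suc; z≤n; s≤s)
import Data.Nat.Properties as ℕₚ
open import Data.Integer.Base as ℤ using (ℤ; +_; -[1+_]; ∣_∣)
import Data.Integer.Properties as ℤₚ
open import Data.Integer.Divisibility.Signed using (_∣_; _∣?_)
open import Data.Rational.Base using (ℚ; _+_; _-_; _*_; _/_; floor)
open import Data.Fin.Base using (Fin; toℕ)
open import Data.List.Base using (List; _++_; map; filter; length; upTo; allFin; cartesianProduct)
open import Data.List.Membership.Propositional using (_∈_)
open import Data.List.Membership.Propositional.Properties
  using (∈-map⁺; ∈-map⁻; ∈-++⁺ˡ; ∈-++⁺ʳ; ∈-upTo⁺; ∈-filter⁺; ∈-filter⁻; ∈-cartesianProduct⁺)
open import Data.List.Relation.Binary.Disjoint.Propositional using (Disjoint)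
open import Data.List.Relation.Unary.Unique.Propositional using (Unique)
import Data.List.Relation.Unary.Unique.Propositional.Properties as Unique
open import Data.Product.Base using (_×_; _,_; proj₂)
open import Function.Bundles using (_⇔_; mk⇔)
open import Relation.Binary.PropositionalEquality using (_≡_; refl; sym; trans; cong; cong₂; subst)
open import Relation.Unary using (Decidable)

-- The library's `fracPart` is the distance to the truncation, which differs
-- from x - ⌊x⌋ at negative non-integers.
frac : ℚ → ℚ
frac x = x - floor x / 1

infix 4 _≡_[mod_]
_≡_[mod_] : ℤ → ℤ → ℕ → Set
a ≡ b [mod m ] = + m ∣ (a ℤ.- b)

-- An index j in {0, …, n - 1} stands for k = j + 1.
quotient : (n : ℕ) (α ν : ℚ) → Fin n → ℤ
quotient n α ν j = floor ((+ n / 1 - ν) * (+ 1 / suc (toℕ j)) + α)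

Counted : (n : ℕ) (α ν : ℚ) (r : ℤ) (m : ℕ) → Fin n → Set
Counted n α ν r m j = quotient n α ν j ≡ r [mod m ]

counted? : ∀ n α ν r m → Decidable (Counted n α ν r m)
counted? n α ν r m j = + m ∣? (quotient n α ν j ℤ.- r)

𝒩 : (n : ℕ) (α ν : ℚ) (r : ℤ) (m : ℕ) → ℕ
𝒩 n α ν r m = length (filter (counted? n α ν r m) (allFin n))

record Enumeration {A : Set} (P : A → Set) : Set where
  field
    elements : List A
    unique   : Unique elements
    complete : ∀ a → a ∈ elements ⇔ P a

-- Independent of the enumeration, since any two are permutations of each other.
# : ∀ {A : Set} {P : A → Set} → Enumeration P → ℕ
# e = length (Enumeration.elements e)

InEllipse : ℕ → ℤ × ℤ → Set
InEllipse n (x , y) = x ℤ.^ 2 ℤ.+ + 2 ℤ.* y ℤ.^ 2 ℤ.≤ + n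

interval : ℕ → List ℤ
interval n = map +_ (upTo (suc n)) ++ map -[1+_] (upTo n)

interval-unique : ∀ n → Unique (interval n)
interval-unique n = Unique.++⁺
  (Unique.map⁺ ℤₚ.+-injective (Unique.upTo⁺ (suc n)))
  (Unique.map⁺ ℤₚ.-[1+-injective (Unique.upTo⁺ n)) disj
  where
  disj : Disjoint (map +_ (upTo (suc n))) (map -[1+_] (upTo n))
  disj (p , q) with ∈-map⁻ +_ p | ∈-map⁻ -[1+_] q
  ... | _ , _ , refl | _ , _ , ()

box : ℕ → List (ℤ × ℤ)
box n = cartesianProduct (interval n) (interval n)

∈-interval : ∀ n x → ∣ x ∣ ℕ.≤ n → x ∈ interval n
∈-interval n (+ i)    i≤n = ∈-++⁺ˡ (∈-map⁺ +_ (∈-upTo⁺ (s≤s i≤n)))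
∈-interval n -[1+ i ] i<n = ∈-++⁺ʳ (map +_ (upTo (suc n))) (∈-map⁺ -[1+_] (∈-upTo⁺ i<n))

square : ∀ x → x ℤ.^ 2 ≡ + (∣ x ∣ ℕ.* ∣ x ∣)
square x = trans (cong (x ℤ.*_) (ℤₚ.*-identityʳ x)) (lemma x)
  where
  lemma : ∀ x → x ℤ.* x ≡ + (∣ x ∣ ℕ.* ∣ x ∣)
  lemma (+ i)    = sym (ℤₚ.pos-* i i)
  lemma -[1+ i ] = refl

form : ∀ x y → x ℤ.^ 2 ℤ.+ + 2 ℤ.* y ℤ.^ 2
             ≡ + (∣ x ∣ ℕ.* ∣ x ∣ ℕ.+ 2 ℕ.* (∣ y ∣ ℕ.* ∣ y ∣))
form x y = cong₂ ℤ._+_ (square x)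
  (trans (cong (+ 2 ℤ.*_) (square y)) (sym (ℤₚ.pos-* 2 (∣ y ∣ ℕ.* ∣ y ∣))))

i≤i*i : ∀ i → i ℕ.≤ i ℕ.* i
i≤i*i zero      = z≤n
i≤i*i i@(suc _) = ℕₚ.m≤m*n i i

ellipse⊆box : ∀ n x y → InEllipse n (x , y) → ∣ x ∣ ℕ.≤ n × ∣ y ∣ ℕ.≤ n
ellipse⊆box n x y p =
    ℕₚ.≤-trans (i≤i*i ∣ x ∣) (ℕₚ.≤-trans (ℕₚ.m≤m+n a (2 ℕ.* b)) q)
  , ℕₚ.≤-trans (i≤i*i ∣ y ∣) (ℕₚ.≤-trans (ℕₚ.m≤m+n b (b ℕ.+ 0)) (ℕₚ.≤-trans (ℕₚ.m≤n+m (2 ℕ.* b) a) q))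
  where
  a b : ℕ
  a = ∣ x ∣ ℕ.* ∣ x ∣
  b = ∣ y ∣ ℕ.* ∣ y ∣

  q : a ℕ.+ 2 ℕ.* b ℕ.≤ n
  q = ℤₚ.drop‿+≤+ (subst (ℤ._≤ + n) (form x y) p)

inEllipse? : ∀ n → Decidable (InEllipse n)
inEllipse? n (x , y) = x ℤ.^ 2 ℤ.+ + 2 ℤ.* y ℤ.^ 2 ℤₚ.≤? + n

ellipse : ∀ n → Enumeration (InEllipse n)
ellipse n = record
  { elements = filter (inEllipse? n) (box n)
  ; unique   = Unique.filter⁺ (inEllipse? n)
                 (Unique.cartesianProduct⁺ (interval-unique n) (interval-unique n))
  ; complete = λ a → mk⇔ (λ a∈ → proj₂ (∈-filter⁻ (inEllipse? n) {xs = box n} a∈))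
                         (λ Pa → ∈-filter⁺ (inEllipse? n) (∈box a Pa) Pa)
  }
  where
  ∈box : ∀ a → InEllipse n a → a ∈ box n
  ∈box (x , y) p with ellipse⊆box n x y p
  ... | x≤ , y≤ = ∈-cartesianProduct⁺ (∈-interval n x x≤) (∈-interval n y y≤)

F : ℕ → ℕ
F n = # (ellipse n)

{-# OPTIONS --safe #-}
module Submission where

-- Let χ = (−2/·), let r(k) count the solutions of x² + 2y² = k, and let g(k) be the sum of χ over
-- the divisors of k.  Then r(k) = 2 g(k) for k ≥ 1, because r and g both satisfy the Hecke relation
--   f(pk) + χ(p) f(k/p) = (1 + χ(p)) f(k)        (p prime, f(k/p) = 0 if p ∤ k),
-- which determines f from f(1).  For r this comes from multiplying by elements of ℤ[√−2]: by √−2 if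
-- p = 2, by p if −2 is not a square modulo p, and by a ± b√−2 if it is, in which case p = a² + 2b² by
-- descent.  That χ(p) tells these cases apart follows from x² + 2y² ≢ 5, 7 (mod 8) in one direction.
-- In the other, if −2 is not a square then pairing factors with product −2 gives
-- (p−1)! ≡ (−2)^((p−1)/2) (mod p); Gauss's lemma evaluates this as 1 if p ≡ 1, 3 (mod 8), against Wilson.
--
-- Summing over k ≤ n gives F(n) = 1 + 2 Σₑ S(⌊n/e⌋) with S(t) = χ(1) + ⋯ + χ(t), and S(t) is the number
-- of odd integers among ⌊(t+3)/4⌋ and ⌊(t+1)/4⌋.  The terms e ≤ ⌈n/4⌉ are the two counts 𝒩.  For
-- e > ⌈n/4⌉ the quotient is 1, 2 or 3, and it is 3 exactly for e ≤ ⌊n/3⌋; since ⌈n/4⌉ ≤ ⌊n/3⌋ unless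
-- n is 1, 2 or 5, these terms contribute (n − ⌈n/4⌉) + (⌊n/3⌋ − ⌈n/4⌉).

open import Defs
open import Data.Nat.Base using (ℕ) renaming (_≤_ to _≤ℕ_)
open import Data.Integer.Base using (ℤ; +_; -_; ∣_∣; _+_; _-_; _*_)
open import Data.Rational.Base using (_/_; floor; ceiling)
open import Data.Product.Base using (_×_)
open import Relation.Binary.PropositionalEquality using (_≡_; _≢_)

open import Data.Nat.Base as ℕ using (zero; suc; z≤n; s≤s; NonZero; _!)
import Data.Nat.Properties as ℕₚ
import Data.Nat.Divisibility as ℕ∣
import Data.Nat.DivMod as ℕ%
open import Data.Nat.Coprimality using (Coprime; coprime-Bézout; coprime-divisor)
open import Data.Nat.GCD using (module Bézout)
open import Data.Nat.Induction using (<-rec)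
open import Data.Nat.ListAction using (product)
open import Data.Nat.ListAction.Properties using (product-↭)
open import Data.Nat.Primality
  using (Prime; prime[2]; ¬prime[1]; euclidsLemma; prime⇒nonZero; prime⇒nonTrivial; prime⇒irreducible)
open import Data.Nat.Primality.Factorisation using (factorise; module PrimeFactorisation)
import Data.Nat.Tactic.RingSolver as ℕ-Solver
open import Data.Integer.Base as ℤ using (-[1+_]; _^_; +≤+)
import Data.Integer.Properties as ℤₚ
import Data.Integer.DivMod as ℤ%
open import Data.Integer.Divisibility.Signed hiding (quotient)
open import Data.Integer.Tactic.RingSolver using (solve-∀)
import Data.Rational.Base as ℚ
import Data.Rational.Properties as ℚₚ
import Data.Rational.Unnormalised.Base as ℚᵘ
import Data.Rational.Unnormalised.Properties as ℚᵘₚ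
open import Data.Fin.Base as Fin using (Fin; toℕ; fromℕ<)
import Data.Fin.Properties as Finₚ
open import Data.List.Base using (List; []; _∷_; _++_; map; filter; length; downFrom; tabulate)
import Data.List.Properties as Listₚ
open import Data.List.Membership.Propositional using (_∈_)
open import Data.List.Membership.Propositional.Properties
open import Data.List.Relation.Binary.Permutation.Propositional using (_↭_; ↭-sym; ↭⇒↭ₛ)
open import Data.List.Relation.Binary.Permutation.Propositional.Properties using (shift; ↭-length; ∈-resp-↭)
import Data.List.Relation.Binary.Permutation.Setoid.Properties as Permutationₛ
open import Data.List.Relation.Unary.All as All using (All; []; _∷_)
open import Data.List.Relation.Unary.AllPairs using ([]; _∷_)
open import Data.List.Relation.Unary.Any using (here; there)
open import Data.List.Relation.Unary.Unique.Propositional using (Unique)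
import Data.List.Relation.Unary.Unique.Propositional.Properties as Uniqueₚ
open import Data.Empty using (⊥; ⊥-elim)
open import Data.Product.Base using (_,_; proj₁; proj₂; ∃; ∃₂)
open import Data.Sum.Base using (_⊎_; inj₁; inj₂)
open import Function.Base using (_∘_; id)
open import Function.Bundles using (mk⇔; Equivalence)
open import Relation.Binary.PropositionalEquality using (refl; sym; trans; cong; cong₂; subst; module ≡-Reasoning)
open import Relation.Binary.PropositionalEquality.Properties using (setoid)
open import Relation.Nullary using (¬_; Dec; yes; no; ¬?)
open import Relation.Nullary.Decidable using (from-yes; _⊎-dec_)
open import Relation.Unary using (Decidable)

-- Cardinalities of enumerations

-- The Hecke relation stands in for unique factorisation in ℤ[√-2] and for the multiplicativity of
-- r. At n = p q it yields f(n) from f(q) and f(q/p), both at smaller arguments, and it has one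
-- shape for ramified, inert and split primes. Comparing r at p k, k and k/p needs only
-- multiplication by p or by elements of norm p, so every count is settled by explicit bijections.
-- The pairing argument produces no square root of -2; it only refutes the absence of one. Since a
-- root modulo p can be searched for, that is enough. The parameters of `𝒩` come from its first
-- argument being both the range of k and the numerator. The floors wanted are those of (n/k + a)/4
-- with a = 3, 1, so the numerator should be n/4; it need not be an integer and is written as ⌈n/4⌉
-- minus ν. The price is that k stops at ⌈n/4⌉, which is why the remaining terms must be summed in
-- closed form.

private variable
  A B : Set

-- Pigeonhole by induction: one occurrence of the head of `xs` is deleted from `ys`, and uniqueness
-- keeps the tail of `xs` inside what remains.
Unique-⊆⇒≤ : ∀ {xs ys : List A} → Unique xs → (∀ {x} → x ∈ xs → x ∈ ys) → length xs ≤ℕ length ys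
Unique-⊆⇒≤ [] _ = z≤n
Unique-⊆⇒≤ {xs = x ∷ xs} (x∉ ∷ uniq) ⊆ys with ∈-∃++ (⊆ys (here refl))
... | as , bs , refl = ℕₚ.≤-trans (s≤s (Unique-⊆⇒≤ uniq avoid)) (ℕₚ.≤-reflexive (sym length-insert))
  where
  length-insert : length (as ++ x ∷ bs) ≡ suc (length (as ++ bs))
  length-insert = trans (Listₚ.length-++ as)
    (trans (ℕₚ.+-suc (length as) (length bs)) (cong suc (sym (Listₚ.length-++ as))))
  avoid : ∀ {y} → y ∈ xs → y ∈ as ++ bs
  avoid y∈ with ∈-++⁻ as (⊆ys (there y∈))
  ... | inj₁ y∈as         = ∈-++⁺ˡ y∈as
  ... | inj₂ (here refl)  = ⊥-elim (All.lookup x∉ y∈ refl)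
  ... | inj₂ (there y∈bs) = ∈-++⁺ʳ as y∈bs

module _ {P : A → Set} (e : Enumeration P) where
  open Enumeration e

  sound : ∀ {a} → a ∈ elements → P a
  sound {a} = Equivalence.to (complete a)

  member : ∀ {a} → P a → a ∈ elements
  member {a} = Equivalence.from (complete a)

#-injection : {P : A → Set} {Q : B → Set} (e : Enumeration P) (e′ : Enumeration Q) (f : A → B) →
  (∀ {a} → P a → Q (f a)) → (∀ {a a′} → f a ≡ f a′ → a ≡ a′) → # e ≤ℕ # e′
#-injection e e′ f P⇒Q inj = ℕₚ.≤-trans (ℕₚ.≤-reflexive (sym (Listₚ.length-map f (elements e))))
  (Unique-⊆⇒≤ (Uniqueₚ.map⁺ inj (unique e)) λ b∈ → image (∈-map⁻ f b∈))
  where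
  open Enumeration
  image : ∀ {b} → ∃ (λ a → a ∈ elements e × b ≡ f a) → b ∈ elements e′
  image (a , a∈ , refl) = member e′ (P⇒Q (sound e a∈))

#-bijection : {P : A → Set} {Q : B → Set} (e : Enumeration P) (e′ : Enumeration Q) (f : A → B) →
  (∀ {a} → P a → Q (f a)) → (∀ {a a′} → f a ≡ f a′ → a ≡ a′) →
  (∀ {b} → Q b → ∃ λ a → P a × b ≡ f a) → # e ≡ # e′
#-bijection e e′ f P⇒Q inj surj = ℕₚ.≤-antisym (#-injection e e′ f P⇒Q inj)
  (ℕₚ.≤-trans (Unique-⊆⇒≤ (unique e′) λ b∈ → preimage (surj (sound e′ b∈)))
    (ℕₚ.≤-reflexive (Listₚ.length-map f (elements e))))
  where
  open Enumeration
  preimage : ∀ {b} → ∃ (λ a → _ × b ≡ f a) → b ∈ map f (elements e)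
  preimage (a , Pa , refl) = ∈-map⁺ f (member e Pa)

module _ {P : A → Set} (e : Enumeration P) {Q : A → Set} (Q? : Decidable Q) where
  restrict : Enumeration (λ a → P a × Q a)
  restrict = record
    { elements = filter Q? (elements)
    ; unique   = Uniqueₚ.filter⁺ Q? unique
    ; complete = λ a → mk⇔
        (λ a∈ → sound e (proj₁ (∈-filter⁻ Q? {xs = elements} a∈)) , proj₂ (∈-filter⁻ Q? {xs = elements} a∈))
        (λ (Pa , Qa) → ∈-filter⁺ Q? (member e Pa) Qa)
    }
    where open Enumeration e

length-filter-¬ : {Q : A → Set} (Q? : Decidable Q) (xs : List A) →
  length xs ≡ length (filter Q? xs) ℕ.+ length (filter (¬? ∘ Q?) xs)
length-filter-¬ Q? [] = refl
length-filter-¬ Q? (x ∷ xs) with Q? x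
... | yes _ = cong suc (length-filter-¬ Q? xs)
... | no  _ = trans (cong suc (length-filter-¬ Q? xs)) (sym (ℕₚ.+-suc _ _))

#-split : {P : A → Set} (e : Enumeration P) {Q : A → Set} (Q? : Decidable Q) →
  # e ≡ # (restrict e Q?) ℕ.+ # (restrict e (¬? ∘ Q?))
#-split e Q? = length-filter-¬ Q? (Enumeration.elements e)

-- Divisibility by primes, and the norm form of ℤ[√−2]

prime-∣-* : ∀ {p} → Prime p → ∀ x y → + p ∣ x * y → (+ p ∣ x) ⊎ (+ p ∣ y)
prime-∣-* {p} pr x y p∣xy with euclidsLemma ∣ x ∣ ∣ y ∣ pr (subst (p ℕ∣.∣_) (ℤₚ.abs-* x y) (∣⇒∣ᵤ p∣xy))
... | inj₁ d = inj₁ (∣ᵤ⇒∣ d)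
... | inj₂ d = inj₂ (∣ᵤ⇒∣ d)

∤-* : ∀ {p} → Prime p → ∀ x y → ¬ + p ∣ x → ¬ + p ∣ y → ¬ + p ∣ x * y
∤-* pr x y p∤x p∤y d with prime-∣-* pr x y d
... | inj₁ p∣x = p∤x p∣x
... | inj₂ p∣y = p∤y p∣y

prime-∣-cancelˡ : ∀ {p} → Prime p → ∀ x {y} → ¬ + p ∣ x → + p ∣ x * y → + p ∣ y
prime-∣-cancelˡ pr x {y} p∤x d with prime-∣-* pr x y d
... | inj₁ p∣x = ⊥-elim (p∤x p∣x)
... | inj₂ p∣y = p∣y

∤-between : ∀ {p n} → 1 ≤ℕ n → n ℕ.< p → ¬ + p ∣ + n
∤-between {n = suc n} _ n<p p∣n = ℕₚ.<⇒≱ n<p (ℕ∣.∣⇒≤ (∣⇒∣ᵤ p∣n))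

inverse-ℕ : ∀ {p} → Prime p → ∀ n → ¬ + p ∣ + n → ∃ λ y → + p ∣ + n * y - + 1
inverse-ℕ {p} pr n p∤n with coprime-Bézout coprime
  where
  coprime : Coprime p n
  coprime (d∣p , d∣n) with prime⇒irreducible pr d∣p
  ... | inj₁ d≡1  = d≡1
  ... | inj₂ refl = ⊥-elim (p∤n (∣ᵤ⇒∣ d∣n))
... | Bézout.+- a b eq = - + b , divides (- + a) (lemma (+ n) (+ b) (+ a) (+ p)
        (trans (cong (_+_ (+ 1)) (sym (ℤₚ.pos-* b n))) (trans (cong +_ eq) (ℤₚ.pos-* a p))))
  where
  lemma : ∀ n b a p → + 1 + b * n ≡ a * p → n * (- b) - + 1 ≡ - a * p
  lemma n b a p eq = trans (regroup n b) (trans (cong -_ eq) (ℤₚ.neg-distribˡ-* a p))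
    where
    regroup : ∀ n b → n * (- b) - + 1 ≡ - (+ 1 + b * n)
    regroup = solve-∀
... | Bézout.-+ a b eq = + b , divides (+ a) (lemma (+ n) (+ b) (+ a) (+ p)
        (trans (cong (_+_ (+ 1)) (sym (ℤₚ.pos-* a p))) (trans (cong +_ eq) (ℤₚ.pos-* b n))))
  where
  lemma : ∀ n b a p → + 1 + a * p ≡ b * n → n * b - + 1 ≡ a * p
  lemma n b a p eq = trans (cong (_- + 1) (trans (ℤₚ.*-comm n b) (sym eq))) (drop a p)
    where
    drop : ∀ a p → + 1 + a * p - + 1 ≡ a * p
    drop = solve-∀

inverse : ∀ {p} → Prime p → ∀ x → ¬ + p ∣ x → ∃ λ y → + p ∣ x * y - + 1
inverse pr (+ n)    p∤n = inverse-ℕ pr n p∤n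
inverse pr -[1+ n ] p∤n with inverse-ℕ pr (suc n) (λ d → p∤n (∣m⇒∣-m d))
... | y , d = - y , subst (λ t → _ ∣ t - + 1) (flip (+ suc n) y) d
  where
  flip : ∀ x y → x * y ≡ - x * - y
  flip = solve-∀

norm : ℤ × ℤ → ℤ
norm (x , y) = x * x + + 2 * (y * y)

norm≡^ : ∀ x y → norm (x , y) ≡ x ^ 2 + + 2 * y ^ 2
norm≡^ x y = cong₂ (λ a b → a + + 2 * b) (cong (x *_) (sym (ℤₚ.*-identityʳ x))) (cong (y *_) (sym (ℤₚ.*-identityʳ y)))

norm≡ : ∀ x y → norm (x , y) ≡ + (∣ x ∣ ℕ.* ∣ x ∣ ℕ.+ 2 ℕ.* (∣ y ∣ ℕ.* ∣ y ∣))
norm≡ x y = trans (norm≡^ x y) (form x y)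

infixl 7 _⊗_
-- Multiplication in ℤ[√-2], with (a , b) standing for a + b√-2.
_⊗_ : ℤ × ℤ → ℤ × ℤ → ℤ × ℤ
(a , b) ⊗ (x , y) = a * x - + 2 * (b * y) , a * y + b * x

conj : ℤ × ℤ → ℤ × ℤ
conj (a , b) = a , - b

norm-⊗ : ∀ α β → norm (α ⊗ β) ≡ norm α * norm β
norm-⊗ (a , b) (x , y) = identity a b x y
  where
  identity : ∀ a b x y → (a * x - + 2 * (b * y)) * (a * x - + 2 * (b * y)) + + 2 * ((a * y + b * x) * (a * y + b * x))
                       ≡ (a * a + + 2 * (b * b)) * (x * x + + 2 * (y * y))
  identity = solve-∀

norm-conj : ∀ π → norm (conj π) ≡ norm π
norm-conj (a , b) = identity a b
  where
  identity : ∀ a b → a * a + + 2 * (- b * - b) ≡ a * a + + 2 * (b * b)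
  identity = solve-∀

-- Descent: primes modulo which −2 is a square

-- Rounding to the nearest multiple of m. Residues between 0 and m - 1 could have a norm as large as
-- 3(m - 1)², too large for a descent.
centred : ∀ m .{{_ : NonZero m}} x → ∃₂ λ x′ q → x ≡ x′ + q * + m × 2 ℕ.* ∣ x′ ∣ ≤ℕ m
centred m x with 2 ℕ.* (x ℤ%.%ℕ m) ℕₚ.≤? m
... | yes small = + (x ℤ%.%ℕ m) , x ℤ%./ℕ m , ℤ%.a≡a%ℕn+[a/ℕn]*n x m , small
... | no  large = - + (m ℕ.∸ r) , x ℤ%./ℕ m + + 1 , equation , bound
  where
  r : ℕ
  r = x ℤ%.%ℕ m
  r≤m : r ≤ℕ m
  r≤m = ℕₚ.<⇒≤ (ℤ%.n%ℕd<d x m)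
  equation : x ≡ - + (m ℕ.∸ r) + (x ℤ%./ℕ m + + 1) * + m
  equation = begin
    x                                              ≡⟨ ℤ%.a≡a%ℕn+[a/ℕn]*n x m ⟩
    + r + (x ℤ%./ℕ m) * + m                        ≡⟨ regroup (+ r) (x ℤ%./ℕ m) (+ m) ⟩
    - (+ m - + r) + (x ℤ%./ℕ m + + 1) * + m        ≡⟨ cong (λ t → - t + (x ℤ%./ℕ m + + 1) * + m)
                                                       (trans (ℤₚ.[+m]-[+n]≡m⊖n m r) (ℤₚ.⊖-≥ r≤m)) ⟩
    - + (m ℕ.∸ r) + (x ℤ%./ℕ m + + 1) * + m        ∎
    where
    open ≡-Reasoning
    regroup : ∀ r q m → r + q * m ≡ - (m - r) + (q + + 1) * m
    regroup = solve-∀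
  bound : 2 ℕ.* ∣ - + (m ℕ.∸ r) ∣ ≤ℕ m
  bound = begin
    2 ℕ.* ∣ - + (m ℕ.∸ r) ∣   ≡⟨ cong (2 ℕ.*_) (ℤₚ.∣-i∣≡∣i∣ (+ (m ℕ.∸ r))) ⟩
    2 ℕ.* (m ℕ.∸ r)           ≡⟨ ℕₚ.*-distribˡ-∸ 2 m r ⟩
    2 ℕ.* m ℕ.∸ 2 ℕ.* r       ≤⟨ ℕₚ.∸-monoʳ-≤ (2 ℕ.* m) (ℕₚ.<⇒≤ (ℕₚ.≰⇒> large)) ⟩
    2 ℕ.* m ℕ.∸ m             ≡⟨ cong (ℕ._∸ m) (cong (m ℕ.+_) (ℕₚ.+-identityʳ m)) ⟩
    m ℕ.+ m ℕ.∸ m             ≡⟨ ℕₚ.m+n∸n≡m m m ⟩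
    m                         ∎
    where open ℕₚ.≤-Reasoning

-- Centred coordinates have norm at most 3m²/4. As 3/4 < 1, dividing that norm by m leaves a
-- quotient below m.
4*norm-centred : ∀ {m a b} → 2 ℕ.* a ≤ℕ m → 2 ℕ.* b ≤ℕ m → 4 ℕ.* (a ℕ.* a ℕ.+ 2 ℕ.* (b ℕ.* b)) ≤ℕ 3 ℕ.* (m ℕ.* m)
4*norm-centred {m} {a} {b} 2a≤m 2b≤m = begin
  4 ℕ.* (a ℕ.* a ℕ.+ 2 ℕ.* (b ℕ.* b))                        ≡⟨ regroup a b ⟩
  2 ℕ.* a ℕ.* (2 ℕ.* a) ℕ.+ 2 ℕ.* (2 ℕ.* b ℕ.* (2 ℕ.* b))  ≤⟨ ℕₚ.+-mono-≤ (ℕₚ.*-mono-≤ 2a≤m 2a≤m) (ℕₚ.*-monoʳ-≤ 2 (ℕₚ.*-mono-≤ 2b≤m 2b≤m)) ⟩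
  m ℕ.* m ℕ.+ 2 ℕ.* (m ℕ.* m)                                ∎
  where
  open ℕₚ.≤-Reasoning
  regroup : ∀ a b → 4 ℕ.* (a ℕ.* a ℕ.+ 2 ℕ.* (b ℕ.* b)) ≡ 2 ℕ.* a ℕ.* (2 ℕ.* a) ℕ.+ 2 ℕ.* (2 ℕ.* b ℕ.* (2 ℕ.* b))
  regroup = ℕ-Solver.solve-∀

square≡0 : ∀ n → n ℕ.* n ≡ 0 → n ≡ 0
square≡0 zero _ = refl

Represented : ℕ → Set
Represented n = ∃ λ α → norm α ≡ + n

module _ {p : ℕ} (pr : Prime p) where

  -- Multiply x + y√−2 by the conjugate of its centred residue x′ + y′√−2 modulo m, and divide by m.
  descent-step : ∀ m → (∀ {k} → k ℕ.< m → 1 ≤ℕ k → k ℕ.< p → Represented (k ℕ.* p) → Represented p) →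
    2 ≤ℕ m → m ℕ.< p → Represented (m ℕ.* p) → Represented p
  descent-step (suc zero) _ (s≤s ()) _ _
  descent-step m@(suc (suc _)) rec 2≤m m<p ((x , y) , eq)
    with centred m x | centred m y
  ... | x′ , q , x≡ , x′-small | y′ , s , y≡ , y′-small = finish m∣N
    where
    N : ℕ
    N = ∣ x′ ∣ ℕ.* ∣ x′ ∣ ℕ.+ 2 ℕ.* (∣ y′ ∣ ℕ.* ∣ y′ ∣)
    -- m t is the change in the norm when x, y are replaced by x′, y′. As norm (x , y) = m p, the
    -- new norm is m (p - t).
    t k : ℤ
    t = q * (+ 2 * x′ + q * + m) + + 2 * (s * (+ 2 * y′ + s * + m))
    k = + p - t
    norm′ : norm (x′ , y′) ≡ k * + m
    norm′ = begin
      norm (x′ , y′) ≡⟨ expand x′ y′ q s (+ m) ⟩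
      norm (x′ + q * + m , y′ + s * + m) - t * + m
        ≡⟨ cong (_- t * + m)
             (trans (cong₂ (λ u v → norm (u , v)) (sym x≡) (sym y≡)) (trans eq (ℤₚ.pos-* m p))) ⟩
      + m * + p - t * + m ≡⟨ collect (+ m) (+ p) t ⟩
      k * + m ∎
      where
      open ≡-Reasoning
      expand : ∀ x y q s m → x * x + + 2 * (y * y) ≡
        (x + q * m) * (x + q * m) + + 2 * ((y + s * m) * (y + s * m))
          - (q * (+ 2 * x + q * m) + + 2 * (s * (+ 2 * y + s * m))) * m
      expand = solve-∀
      collect : ∀ m p t → m * p - t * m ≡ (p - t) * m
      collect = solve-∀
    m∣N : m ℕ∣.∣ N
    m∣N = ∣⇒∣ᵤ (divides k (trans (sym (norm≡ x′ y′)) norm′))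
    finish : m ℕ∣.∣ N → Represented p
    -- Norm 0 gives x′ = y′ = 0, so m² ∣ m p and m ∣ p, impossible for 1 < m < p.
    finish (ℕ∣.divides zero N≡0) with prime⇒irreducible pr (∣⇒∣ᵤ (divides (q * q + + 2 * (s * s)) p≡))
      where
      ∣x′∣≡0 : ∣ x′ ∣ ≡ 0
      ∣x′∣≡0 = square≡0 _ (ℕₚ.m+n≡0⇒m≡0 _ N≡0)
      ∣y′∣≡0 : ∣ y′ ∣ ≡ 0
      ∣y′∣≡0 = square≡0 _ (ℕₚ.m+n≡0⇒m≡0 _ (ℕₚ.m+n≡0⇒n≡0 (∣ x′ ∣ ℕ.* ∣ x′ ∣) N≡0))
      multiple : ∀ {z} z′ t → ∣ z′ ∣ ≡ 0 → z ≡ z′ + t * + m → z ≡ t * + m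
      multiple z′ t ∣z′∣≡0 z≡ = trans z≡
        (trans (cong (_+ t * + m) (ℤₚ.∣i∣≡0⇒i≡0 {z′} ∣z′∣≡0)) (ℤₚ.+-identityˡ (t * + m)))
      p≡ : + p ≡ (q * q + + 2 * (s * s)) * + m
      p≡ = ℤₚ.*-cancelˡ-≡ (+ m) (+ p) _ (begin
        + m * + p ≡⟨ ℤₚ.pos-* m p ⟨
        + (m ℕ.* p) ≡⟨ eq ⟨
        norm (x , y) ≡⟨ cong₂ (λ u v → norm (u , v)) (multiple x′ q ∣x′∣≡0 x≡) (multiple y′ s ∣y′∣≡0 y≡) ⟩
        norm (q * + m , s * + m) ≡⟨ factor q s (+ m) ⟩
        + m * ((q * q + + 2 * (s * s)) * + m) ∎)
        where
        open ≡-Reasoning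
        factor : ∀ q s m → (q * m) * (q * m) + + 2 * ((s * m) * (s * m)) ≡ m * ((q * q + + 2 * (s * s)) * m)
        factor = solve-∀
    ... | inj₁ ()
    ... | inj₂ refl = ⊥-elim (ℕₚ.<-irrefl refl m<p)
    finish (ℕ∣.divides k′@(suc _) N≡) = rec k′<m (s≤s z≤n) (ℕₚ.<-trans k′<m m<p) ((u , v) , norm-uv)
      where
      k′<m : k′ ℕ.< m
      k′<m = ℕₚ.*-cancelʳ-< (4 ℕ.* m) k′ m (begin-strict
        k′ ℕ.* (4 ℕ.* m)      ≡⟨ rotate k′ m ⟩
        4 ℕ.* (k′ ℕ.* m)      ≡⟨ cong (4 ℕ.*_) N≡ ⟨
        4 ℕ.* N               ≤⟨ 4*norm-centred {a = ∣ x′ ∣} {∣ y′ ∣} x′-small y′-small ⟩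
        3 ℕ.* (m ℕ.* m)       <⟨ ℕₚ.m<n+m (3 ℕ.* (m ℕ.* m)) (ℕ.>-nonZero⁻¹ (m ℕ.* m)) ⟩
        m ℕ.* m ℕ.+ 3 ℕ.* (m ℕ.* m) ≡⟨ rotate m m ⟨
        m ℕ.* (4 ℕ.* m)       ∎)
        where
        open ℕₚ.≤-Reasoning
        rotate : ∀ a b → a ℕ.* (4 ℕ.* b) ≡ 4 ℕ.* (a ℕ.* b)
        rotate = ℕ-Solver.solve-∀
      norm-x′y′ : norm (x′ , y′) ≡ + k′ * + m
      norm-x′y′ = trans (norm≡ x′ y′) (trans (cong +_ N≡) (ℤₚ.pos-* k′ m))
      u v : ℤ
      u = + k′ + q * x′ + + 2 * (s * y′)
      v = s * x′ - q * y′
      -- Modulo m the product is the norm of (x′ , y′), itself a multiple of m; hence m divides both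
      -- coordinates.
      ⊗-conj≡ : (x , y) ⊗ conj (x′ , y′) ≡ (+ m * u , + m * v)
      ⊗-conj≡ = cong₂ _,_
        (begin
          x * x′ - + 2 * (y * - y′)  ≡⟨ cong₂ (λ a b → a * x′ - + 2 * (b * - y′)) x≡ y≡ ⟩
          (x′ + q * + m) * x′ - + 2 * ((y′ + s * + m) * - y′) ≡⟨ first x′ y′ q s (+ m) ⟩
          norm (x′ , y′) + + m * (q * x′ + + 2 * (s * y′)) ≡⟨ cong (_+ + m * (q * x′ + + 2 * (s * y′))) norm-x′y′ ⟩
          + k′ * + m + + m * (q * x′ + + 2 * (s * y′)) ≡⟨ collect (+ k′) (+ m) (q * x′) (+ 2 * (s * y′)) ⟩
          + m * u ∎)
        (begin
          x * - y′ + y * x′ ≡⟨ cong₂ (λ a b → a * - y′ + b * x′) x≡ y≡ ⟩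
          (x′ + q * + m) * - y′ + (y′ + s * + m) * x′ ≡⟨ second x′ y′ q s (+ m) ⟩
          + m * v ∎)
        where
        open ≡-Reasoning
        first : ∀ x y q s m → (x + q * m) * x - + 2 * ((y + s * m) * - y) ≡ x * x + + 2 * (y * y) + m * (q * x + + 2 * (s * y))
        first = solve-∀
        second : ∀ x y q s m → (x + q * m) * - y + (y + s * m) * x ≡ m * (s * x - q * y)
        second = solve-∀
        collect : ∀ k m a b → k * m + m * (a + b) ≡ m * (k + a + b)
        collect = solve-∀
      norm-uv : norm (u , v) ≡ + (k′ ℕ.* p)
      norm-uv = ℤₚ.*-cancelˡ-≡ (+ m * + m) _ _ {{ℤₚ.i*j≢0 (+ m) (+ m)}} (begin
        + m * + m * norm (u , v)                  ≡⟨ scale (+ m) u v ⟩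
        norm (+ m * u , + m * v)                  ≡⟨ cong norm ⊗-conj≡ ⟨
        norm ((x , y) ⊗ conj (x′ , y′))           ≡⟨ norm-⊗ (x , y) (conj (x′ , y′)) ⟩
        norm (x , y) * norm (x′ , - y′)           ≡⟨ cong₂ _*_ (trans eq (ℤₚ.pos-* m p)) (trans (norm-conj (x′ , y′)) norm-x′y′) ⟩
        + m * + p * (+ k′ * + m)                  ≡⟨ swap (+ m) (+ p) (+ k′) ⟩
        + m * + m * (+ k′ * + p)                  ≡⟨ cong (+ m * + m *_) (ℤₚ.pos-* k′ p) ⟨
        + m * + m * + (k′ ℕ.* p)                  ∎)
        where
        open ≡-Reasoning
        scale : ∀ m u v → m * m * (u * u + + 2 * (v * v)) ≡ m * u * (m * u) + + 2 * (m * v * (m * v))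
        scale = solve-∀
        swap : ∀ m p k → m * p * (k * m) ≡ m * m * (k * p)
        swap = solve-∀

  descent : ∀ m → 1 ≤ℕ m → m ℕ.< p → Represented (m ℕ.* p) → Represented p
  descent = <-rec _ step
    where
    step : ∀ m → (∀ {k} → k ℕ.< m → 1 ≤ℕ k → k ℕ.< p → Represented (k ℕ.* p) → Represented p) →
      1 ≤ℕ m → m ℕ.< p → Represented (m ℕ.* p) → Represented p
    step 1 _ _ _ (α , eq) = α , trans eq (cong +_ (ℕₚ.*-identityˡ p))
    step m@(suc (suc _)) rec _ = descent-step m rec (s≤s (s≤s z≤n))

  -- With z centred, z² + 2·1² = m p where 4 m p ≤ p² + 8 < 4 p², so the descent starts with a
  -- multiplier below p.
  residue⇒represented : ∀ z → + p ∣ z * z + + 2 → Represented p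
  residue⇒represented z p∣z²+2 with centred p {{prime⇒nonZero pr}} z
  ... | z′ , q , z≡ , small = finish (∣⇒∣ᵤ (subst (+ p ∣_) (norm≡ z′ (+ 1)) p∣norm))
    where
    p∣norm : + p ∣ norm (z′ , + 1)
    p∣norm = subst (+ p ∣_) (trans (cong (λ t → t * t + + 2 - (+ 2 * z′ + q * + p) * q * + p) z≡) (reduce z′ q (+ p)))
      (∣m∣n⇒∣m-n p∣z²+2 (divides ((+ 2 * z′ + q * + p) * q) refl))
      where
      reduce : ∀ z q p → (z + q * p) * (z + q * p) + + 2 - (+ 2 * z + q * p) * q * p ≡ z * z + + 2 * (+ 1 * + 1)
      reduce = solve-∀
    2≤p : 2 ≤ℕ p
    2≤p = ℕ.nonTrivial⇒n>1 p {{prime⇒nonTrivial pr}}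
    finish : p ℕ∣.∣ ∣ z′ ∣ ℕ.* ∣ z′ ∣ ℕ.+ 2 → Represented p
    finish (ℕ∣.divides zero eq) = ⊥-elim (ℕₚ.1+n≢0 (ℕₚ.m+n≡0⇒n≡0 (∣ z′ ∣ ℕ.* ∣ z′ ∣) eq))
    finish (ℕ∣.divides m@(suc _) eq) = descent m (s≤s z≤n) m<p ((z′ , + 1) , trans (norm≡ z′ (+ 1)) (cong +_ eq))
      where
      m<p : m ℕ.< p
      m<p = ℕₚ.*-cancelʳ-< (4 ℕ.* p) m p (begin-strict
        m ℕ.* (4 ℕ.* p)                             ≡⟨ rotate m p ⟩
        4 ℕ.* (m ℕ.* p)                             ≡⟨ cong (4 ℕ.*_) eq ⟨
        4 ℕ.* (∣ z′ ∣ ℕ.* ∣ z′ ∣ ℕ.+ 2)             ≡⟨ distribute ∣ z′ ∣ ⟩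
        2 ℕ.* ∣ z′ ∣ ℕ.* (2 ℕ.* ∣ z′ ∣) ℕ.+ 8       ≤⟨ ℕₚ.+-monoˡ-≤ 8 (ℕₚ.*-mono-≤ small small) ⟩
        p ℕ.* p ℕ.+ 8                               <⟨ ℕₚ.+-monoʳ-< (p ℕ.* p) (ℕₚ.≤-trans (ℕₚ.m≤m+n 9 3) (ℕₚ.*-monoʳ-≤ 3 (ℕₚ.*-mono-≤ 2≤p 2≤p))) ⟩
        p ℕ.* p ℕ.+ 3 ℕ.* (p ℕ.* p)                 ≡⟨ rotate p p ⟨
        p ℕ.* (4 ℕ.* p)                             ∎)
        where
        open ℕₚ.≤-Reasoning
        rotate : ∀ a b → a ℕ.* (4 ℕ.* b) ≡ 4 ℕ.* (a ℕ.* b)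
        rotate = ℕ-Solver.solve-∀
        distribute : ∀ z → 4 ℕ.* (z ℕ.* z ℕ.+ 2) ≡ 2 ℕ.* z ℕ.* (2 ℕ.* z) ℕ.+ 8
        distribute = ℕ-Solver.solve-∀

-- Congruences and Wilson's theorem

-- A record keeps `a` and `b` visible to unification; in the bare divisibility they would be hidden
-- under a subtraction.
record _≋_[_] (a b : ℤ) (p : ℕ) : Set where
  constructor congruent
  field difference : + p ∣ a - b
open _≋_[_]

infix 4 _≋_[_]

module _ {p : ℕ} where
  ≋-reflexive : ∀ {a b} → a ≡ b → a ≋ b [ p ]
  ≋-reflexive {a} refl = congruent (subst (+ p ∣_) (sym (ℤₚ.+-inverseʳ a)) (divides (+ 0) refl))

  ≋-refl : ∀ {a} → a ≋ a [ p ]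
  ≋-refl = ≋-reflexive refl

  ≋-sym : ∀ {a b} → a ≋ b [ p ] → b ≋ a [ p ]
  ≋-sym {a} {b} (congruent d) = congruent (subst (+ p ∣_) (negate a b) (∣m⇒∣-m d))
    where
    negate : ∀ a b → - (a - b) ≡ b - a
    negate = solve-∀

  ≋-trans : ∀ {a b c} → a ≋ b [ p ] → b ≋ c [ p ] → a ≋ c [ p ]
  ≋-trans {a} {b} {c} (congruent d) (congruent e) = congruent (subst (+ p ∣_) (telescope a b c) (∣m∣n⇒∣m+n d e))
    where
    telescope : ∀ a b c → a - b + (b - c) ≡ a - c
    telescope = solve-∀

  ≋-* : ∀ {a b c d} → a ≋ b [ p ] → c ≋ d [ p ] → a * c ≋ b * d [ p ]
  ≋-* {a} {b} {c} {d} (congruent e) (congruent f) =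
    congruent (subst (+ p ∣_) (expand a b c d) (∣m∣n⇒∣m+n (∣m⇒∣m*n c e) (∣n⇒∣m*n b f)))
    where
    expand : ∀ a b c d → (a - b) * c + b * (c - d) ≡ a * c - b * d
    expand = solve-∀

  ≋-∣ : ∀ {a b} → a ≋ b [ p ] → + p ∣ b → + p ∣ a
  ≋-∣ {a} {b} (congruent d) p∣b = subst (+ p ∣_) (cancel a b) (∣m∣n⇒∣m+n d p∣b)
    where
    cancel : ∀ a b → a - b + b ≡ a
    cancel = solve-∀

  ≋-cancelˡ : Prime p → ∀ c {a b} → ¬ + p ∣ c → c * a ≋ c * b [ p ] → a ≋ b [ p ]
  ≋-cancelˡ pr c {a} {b} p∤c (congruent d) =
    congruent (prime-∣-cancelˡ pr c p∤c (subst (+ p ∣_) (factor c a b) d))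
    where
    factor : ∀ c a b → c * a - c * b ≡ c * (a - b)
    factor = solve-∀

  reduced-unique-≤ : ∀ {m n} → n ℕ.< p → m ≤ℕ n → + n ≋ + m [ p ] → m ≡ n
  reduced-unique-≤ {m} {n} n<p m≤n (congruent d) with n ℕ.∸ m in eq
  ... | zero  = ℕₚ.≤-antisym m≤n (ℕₚ.m∸n≡0⇒m≤n eq)
  ... | suc k = ⊥-elim (∤-between (s≤s z≤n) (ℕₚ.≤-<-trans (subst (_≤ℕ n) eq (ℕₚ.m∸n≤m n m)) n<p)
                  (subst (+ p ∣_) (trans (ℤₚ.[+m]-[+n]≡m⊖n n m) (trans (ℤₚ.⊖-≥ m≤n) (cong +_ eq))) d))

  reduced-unique : ∀ {m n} → m ℕ.< p → n ℕ.< p → + m ≋ + n [ p ] → m ≡ n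
  reduced-unique {m} {n} m<p n<p m≋n with ℕₚ.≤-total m n
  ... | inj₁ m≤n = reduced-unique-≤ n<p m≤n (≋-sym m≋n)
  ... | inj₂ n≤m = sym (reduced-unique-≤ m<p n≤m m≋n)

∈-∃-↭ : ∀ {A : Set} {x : A} {xs} → x ∈ xs → ∃ λ ys → xs ↭ x ∷ ys
∈-∃-↭ {x = x} x∈xs with ∈-∃++ x∈xs
... | as , bs , refl = as ++ bs , shift x as bs

module _ {p : ℕ} (c : ℤ) where
  -- Remove x together with its partner y, a pair of product c, and recurse; `functional` guarantees
  -- that the rest is still closed under taking partners. The bound `n` drives the recursion, since
  -- the remaining list is not a sublist in the structural sense. It is applied with c = 1 for
  -- Wilson's theorem and with c = -2 for nonresidues.
  pairing-product : ∀ n xs → length xs ≤ℕ n → Unique xs →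
    (∀ {x} → x ∈ xs → ∃ λ y → y ∈ xs × x ≢ y × (+ x * + y ≋ c [ p ])) →
    (∀ {x y z} → x ∈ xs → y ∈ xs → z ∈ xs → + x * + y ≋ c [ p ] → + x * + z ≋ c [ p ] → y ≡ z) →
    ∃ λ k → length xs ≡ k ℕ.+ k × (+ product xs ≋ c ^ k [ p ])
  pairing-product n [] _ _ _ _ = 0 , refl , ≋-refl
  pairing-product (suc n) (x ∷ xs) (s≤s xs≤n) (x∉xs ∷ uniq) partner functional with partner (here refl)
  ... | y , here y≡x , x≢y , xy = ⊥-elim (x≢y (sym y≡x))
  ... | y , there y∈xs , x≢y , xy with ∈-∃-↭ y∈xs
  ...   | ys , xs↭ = k+1 (pairing-product n ys ys≤n (unique-tail uniq′) partner′ functional′)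
    where
    uniq′ : Unique (y ∷ ys)
    uniq′ = Permutationₛ.Unique-resp-↭ (setoid ℕ) (↭⇒↭ₛ xs↭) uniq
    unique-tail : ∀ {z zs} → Unique {A = ℕ} (z ∷ zs) → Unique zs
    unique-tail (_ ∷ u) = u
    unique-head : ∀ {z w zs} → Unique {A = ℕ} (z ∷ zs) → w ∈ zs → z ≢ w
    unique-head (z∉ ∷ _) w∈ = All.lookup z∉ w∈
    length-xs : length xs ≡ suc (length ys)
    length-xs = ↭-length xs↭
    ys≤n : length ys ≤ℕ n
    ys≤n = ℕₚ.≤-trans (ℕₚ.n≤1+n _) (subst (_≤ℕ n) length-xs xs≤n)
    ⊆xs : ∀ {z} → z ∈ ys → z ∈ xs
    ⊆xs z∈ = ∈-resp-↭ (↭-sym xs↭) (there z∈)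
    commute : ∀ {a b} → + a * + b ≋ c [ p ] → + b * + a ≋ c [ p ]
    commute {a} {b} = subst (_≋ c [ p ]) (ℤₚ.*-comm (+ a) (+ b))
    functional′ : ∀ {a b d} → a ∈ ys → b ∈ ys → d ∈ ys →
      + a * + b ≋ c [ p ] → + a * + d ≋ c [ p ] → b ≡ d
    functional′ a∈ b∈ d∈ = functional (there (⊆xs a∈)) (there (⊆xs b∈)) (there (⊆xs d∈))
    partner′ : ∀ {z} → z ∈ ys → ∃ λ w → w ∈ ys × z ≢ w × (+ z * + w ≋ c [ p ])
    partner′ {z} z∈ with partner (there (⊆xs z∈))
    -- Were z paired with x, it would equal y, the partner of x; the case of y below is symmetric.
    ... | w , here refl , _ , zw = ⊥-elim (unique-head uniq′ z∈
            (functional (here refl) (there y∈xs) (there (⊆xs z∈)) xy (commute {z} zw)))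
    ... | w , there w∈xs , z≢w , zw with ∈-resp-↭ xs↭ w∈xs
    ...   | there w∈ys = w , w∈ys , z≢w , zw
    ...   | here refl  = ⊥-elim (unique-head (x∉xs ∷ uniq) (⊆xs z∈)
            (functional (there y∈xs) (here refl) (there (⊆xs z∈)) (commute {x} xy) (commute {z} zw)))
    k+1 : ∃ (λ k → length ys ≡ k ℕ.+ k × (+ product ys ≋ c ^ k [ p ])) →
      ∃ λ k → suc (length xs) ≡ k ℕ.+ k × (+ product (x ∷ xs) ≋ c ^ k [ p ])
    k+1 (k , length-ys , product-ys) = suc k
      , trans (cong suc (trans length-xs (cong suc length-ys))) (cong suc (sym (ℕₚ.+-suc k k)))
      , ≋-trans (≋-reflexive regroup) (≋-* xy product-ys)
      where
      regroup : + product (x ∷ xs) ≡ + x * + y * + product ys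
      regroup = begin
        + (x ℕ.* product xs)           ≡⟨ cong (λ t → + (x ℕ.* t)) (product-↭ xs↭) ⟩
        + (x ℕ.* (y ℕ.* product ys))   ≡⟨ ℤₚ.pos-* x (y ℕ.* product ys) ⟩
        + x * + (y ℕ.* product ys)     ≡⟨ cong (+ x *_) (ℤₚ.pos-* y (product ys)) ⟩
        + x * (+ y * + product ys)     ≡⟨ ℤₚ.*-assoc (+ x) (+ y) (+ product ys) ⟨
        + x * + y * + product ys       ∎
        where open ≡-Reasoning

-- Listed downwards, so that its product unfolds in the same way as the factorial.
range : ℕ → ℕ → List ℕ
range a n = map (a ℕ.+_) (downFrom n)

length-range : ∀ a n → length (range a n) ≡ n
length-range a n = trans (Listₚ.length-map (a ℕ.+_) (downFrom n)) (Listₚ.length-downFrom n)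

Unique-range : ∀ a n → Unique (range a n)
Unique-range a n = Uniqueₚ.map⁺ (λ {x} {y} → ℕₚ.+-cancelˡ-≡ a x y) (Uniqueₚ.downFrom⁺ n)

∈-range⁻ : ∀ {a n x} → x ∈ range a n → a ≤ℕ x × x ℕ.< a ℕ.+ n
∈-range⁻ {a} {n} x∈ with ∈-map⁻ (a ℕ.+_) x∈
... | i , i∈ , refl = ℕₚ.m≤m+n a i , ℕₚ.+-monoʳ-< a (∈-downFrom⁻ i∈)

∈-range⁺ : ∀ {a n x} → a ≤ℕ x → x ℕ.< a ℕ.+ n → x ∈ range a n
∈-range⁺ {a} {n} {x} a≤x x<a+n = subst (_∈ range a n) (ℕₚ.m+[n∸m]≡n a≤x)
  (∈-map⁺ (a ℕ.+_) (∈-downFrom⁺ (ℕₚ.+-cancelˡ-< a _ _ (subst (ℕ._< a ℕ.+ n) (sym (ℕₚ.m+[n∸m]≡n a≤x)) x<a+n))))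

product-range-1 : ∀ n → product (range 1 n) ≡ n !
product-range-1 zero    = refl
product-range-1 (suc n) = cong (suc n ℕ.*_) (product-range-1 n)

product-range-2 : ∀ n → product (range 2 n) ≡ suc n !
product-range-2 zero    = refl
product-range-2 (suc n) = cong (suc (suc n) ℕ.*_) (product-range-2 n)

solve-linear-identity : ∀ c x z r q p → z * c ≡ r + q * p → c * (x * z - + 1) - x * q * p ≡ x * r - c
solve-linear-identity c x z r q p eq = trans (expand c x z q p)
  (cong (λ t → x * t - c) (trans (cong (_- q * p) eq) (cancel r (q * p))))
  where
  expand : ∀ c x z q p → c * (x * z - + 1) - x * q * p ≡ x * (z * c - q * p) - c
  expand = solve-∀
  cancel : ∀ r t → r + t - t ≡ r
  cancel = solve-∀

module _ {p : ℕ} (pr : Prime p) where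

  private instance
    p≢0 : NonZero p
    p≢0 = prime⇒nonZero pr

  solve-linear : ∀ c x → 1 ≤ℕ x → x ℕ.< p → ∃ λ y → y ℕ.< p × (+ x * + y ≋ c [ p ])
  solve-linear c x 1≤x x<p with inverse pr (+ x) (∤-between 1≤x x<p)
  ... | z , d = (z * c) ℤ%.%ℕ p , ℤ%.n%ℕd<d (z * c) p
              , congruent (subst (+ p ∣_) rearrange (∣m∣n⇒∣m-n (∣n⇒∣m*n c d) (divides (+ x * q) refl)))
    where
    q : ℤ
    q = (z * c) ℤ%./ℕ p
    rearrange : c * (+ x * z - + 1) - + x * q * + p ≡ + x * + ((z * c) ℤ%.%ℕ p) - c
    rearrange = solve-linear-identity c (+ x) z _ q (+ p) (ℤ%.a≡a%ℕn+[a/ℕn]*n (z * c) p)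

  linear-unique : ∀ c x y z → 1 ≤ℕ x → x ℕ.< p → y ℕ.< p → z ℕ.< p →
    + x * + y ≋ c [ p ] → + x * + z ≋ c [ p ] → y ≡ z
  linear-unique c x y z 1≤x x<p y<p z<p xy xz =
    reduced-unique y<p z<p (≋-cancelˡ pr (+ x) {+ y} {+ z} (∤-between 1≤x x<p) (≋-trans {b = c} xy (≋-sym {a = + x * + z} xz)))

  -- When c is not a square modulo p, no x is its own partner in x y ≡ c, so the 2h nonzero residues
  -- form h pairs of product c. This is one half of Euler's criterion, obtained without primitive
  -- roots.
  nonresidue-factorial : ∀ c h → p ≡ suc (h ℕ.+ h) → ¬ + p ∣ c → (∀ x → ¬ (+ x * + x ≋ c [ p ])) →
    + ((h ℕ.+ h) !) ≋ c ^ h [ p ]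
  nonresidue-factorial c h p≡ p∤c nonresidue = conclude
    (pairing-product c (h ℕ.+ h) units (ℕₚ.≤-reflexive (length-range 1 (h ℕ.+ h))) (Unique-range 1 (h ℕ.+ h)) partner functional)
    where
    units : List ℕ
    units = range 1 (h ℕ.+ h)
    bounds : ∀ {x} → x ∈ units → 1 ≤ℕ x × x ℕ.< p
    bounds x∈ with ∈-range⁻ {1} x∈
    ... | 1≤x , x< = 1≤x , subst (_ ℕ.<_) (sym p≡) x<
    functional : ∀ {x y z} → x ∈ units → y ∈ units → z ∈ units →
      + x * + y ≋ c [ p ] → + x * + z ≋ c [ p ] → y ≡ z
    functional {x} {y} {z} x∈ y∈ z∈ =
      linear-unique c x y z (proj₁ (bounds x∈)) (proj₂ (bounds x∈)) (proj₂ (bounds y∈)) (proj₂ (bounds z∈))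
    choose : ∀ x → ∃ (λ y → y ℕ.< p × (+ x * + y ≋ c [ p ])) →
      ∃ λ y → y ∈ units × x ≢ y × (+ x * + y ≋ c [ p ])
    choose x (zero  , _   , xy) = ⊥-elim (p∤c (≋-∣ {a = c} {+ x * + 0} (≋-sym {a = + x * + 0} xy) (divides (+ 0) (ℤₚ.*-zeroʳ (+ x)))))
    choose x (suc y , y<p , xy) = suc y , ∈-range⁺ (s≤s z≤n) (subst (suc y ℕ.<_) p≡ y<p) , (λ { refl → nonresidue x xy }) , xy
    partner : ∀ {x} → x ∈ units → ∃ λ y → y ∈ units × x ≢ y × (+ x * + y ≋ c [ p ])
    partner {x} x∈ = choose x (solve-linear c x (proj₁ (bounds x∈)) (proj₂ (bounds x∈)))
    double-injective : ∀ m n → m ℕ.+ m ≡ n ℕ.+ n → m ≡ n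
    double-injective zero    zero    _  = refl
    double-injective (suc m) (suc n) eq = cong suc (double-injective m n
      (ℕₚ.suc-injective (trans (sym (ℕₚ.+-suc m m)) (trans (ℕₚ.suc-injective eq) (ℕₚ.+-suc n n)))))
    conclude : ∃ (λ k → length units ≡ k ℕ.+ k × (+ product units ≋ c ^ k [ p ])) → + ((h ℕ.+ h) !) ≋ c ^ h [ p ]
    conclude (k , length≡ , product≋) = subst (λ t → + t ≋ c ^ h [ p ]) (product-range-1 (h ℕ.+ h))
      (subst (λ t → + product units ≋ c ^ t [ p ])
        (double-injective k h (trans (sym length≡) (length-range 1 (h ℕ.+ h)))) product≋)

  -- Here n = p - 3. Only 1 and -1 are their own inverses, so 2, ..., p - 2 pair off with product 1
  -- and the factor p - 1 ≡ -1 remains.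
  wilson : ∀ n → p ≡ 3 ℕ.+ n → + (suc (suc n) !) ≋ - + 1 [ p ]
  wilson n p≡ = conclude
    (pairing-product (+ 1) n middle (ℕₚ.≤-reflexive (length-range 2 n)) (Unique-range 2 n) partner functional)
    where
    middle : List ℕ
    middle = range 2 n
    bounds : ∀ {x} → x ∈ middle → 2 ≤ℕ x × suc x ℕ.< p
    bounds x∈ with ∈-range⁻ {2} x∈
    ... | 2≤x , x< = 2≤x , subst (_ ℕ.<_) (sym p≡) (s≤s x<)
    1≤ : ∀ {x} → x ∈ middle → 1 ≤ℕ x
    1≤ x∈ = ℕₚ.<⇒≤ (proj₁ (bounds x∈))
    <p : ∀ {x} → x ∈ middle → x ℕ.< p
    <p x∈ = ℕₚ.<⇒≤ (proj₂ (bounds x∈))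
    functional : ∀ {x y z} → x ∈ middle → y ∈ middle → z ∈ middle →
      + x * + y ≋ + 1 [ p ] → + x * + z ≋ + 1 [ p ] → y ≡ z
    functional {x} {y} {z} x∈ y∈ z∈ = linear-unique (+ 1) x y z (1≤ x∈) (<p x∈) (<p y∈) (<p z∈)
    ∤-pred : ∀ {x} → x ∈ middle → ¬ + p ∣ + x - + 1
    ∤-pred {zero}  x∈ _ = ℕₚ.n≮0 (proj₁ (bounds x∈))
    ∤-pred {suc x} x∈ d =
      ∤-between (ℕ.s≤s⁻¹ (proj₁ (bounds x∈))) (ℕₚ.<-trans (ℕₚ.n<1+n x) (<p x∈)) (subst (+ p ∣_) (ℤₚ.[1+m]⊖[1+n]≡m⊖n x 0) d)
    ∤-suc : ∀ {x} → x ∈ middle → ¬ + p ∣ + x + + 1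
    ∤-suc {x} x∈ d = ∤-between (s≤s z≤n) (proj₂ (bounds x∈)) (subst (+ p ∣_) (cong +_ (ℕₚ.+-comm x 1)) d)
    2≤partner : ∀ x y → x ∈ middle → + p ∣ + x * + y - + 1 → 2 ≤ℕ y
    2≤partner x 0 x∈ d = ⊥-elim (∤-between (s≤s z≤n) (subst (1 ℕ.<_) (sym p≡) (s≤s (s≤s z≤n)))
      (∣m⇒∣-m (subst (λ t → + p ∣ t - + 1) (ℤₚ.*-zeroʳ (+ x)) d)))
    2≤partner x 1 x∈ d = ⊥-elim (∤-pred x∈ (subst (λ t → + p ∣ t - + 1) (ℤₚ.*-identityʳ (+ x)) d))
    2≤partner _ (suc (suc _)) _ _ = s≤s (s≤s z≤n)
    partner<p-1 : ∀ x y → x ∈ middle → y ℕ.< p → + p ∣ + x * + y - + 1 → y ℕ.< 2 ℕ.+ n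
    partner<p-1 x y x∈ y<p d with ℕₚ.m≤n⇒m<n∨m≡n (ℕ.s≤s⁻¹ (subst (y ℕ.<_) p≡ y<p))
    ... | inj₁ y< = y<
    -- If y = p - 1 then x y ≡ -x, so x y ≡ 1 would force p ∣ x + 1.
    ... | inj₂ y≡ = ⊥-elim (∤-suc x∈ (subst (+ p ∣_) (rearrange (+ x) (+ y))
            (∣m∣n⇒∣m-n (divides (+ x) (cong (λ t → + x * + t) (trans (cong suc y≡) (sym p≡)))) d)))
      where
      rearrange : ∀ x y → x * (+ 1 + y) - (x * y - + 1) ≡ x + + 1
      rearrange = solve-∀
    partner≢ : ∀ x → x ∈ middle → ¬ + p ∣ + x * + x - + 1
    partner≢ x x∈ d with prime-∣-* pr (+ x - + 1) (+ x + + 1) (subst (+ p ∣_) (factor (+ x)) d)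
      where
      factor : ∀ x → x * x - + 1 ≡ (x - + 1) * (x + + 1)
      factor = solve-∀
    ... | inj₁ d′ = ∤-pred x∈ d′
    ... | inj₂ d′ = ∤-suc x∈ d′
    choose : ∀ x → x ∈ middle → ∃ (λ y → y ℕ.< p × (+ x * + y ≋ + 1 [ p ])) →
      ∃ λ y → y ∈ middle × x ≢ y × (+ x * + y ≋ + 1 [ p ])
    choose x x∈ (y , y<p , xy) = y , ∈-range⁺ (2≤partner x y x∈ (difference xy)) (partner<p-1 x y x∈ y<p (difference xy))
      , (λ { refl → partner≢ x x∈ (difference xy) }) , xy
    partner : ∀ {x} → x ∈ middle → ∃ λ y → y ∈ middle × x ≢ y × (+ x * + y ≋ + 1 [ p ])
    partner {x} x∈ = choose x x∈ (solve-linear (+ 1) x (1≤ x∈) (<p x∈))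
    p-1 : + (2 ℕ.+ n) ≋ - + 1 [ p ]
    p-1 = congruent (divides (+ 1) (trans (cong +_ (trans (ℕₚ.+-comm (2 ℕ.+ n) 1) (sym p≡))) (sym (ℤₚ.*-identityˡ (+ p)))))
    conclude : ∃ (λ k → length middle ≡ k ℕ.+ k × (+ product middle ≋ (+ 1) ^ k [ p ])) →
      + (suc (suc n) !) ≋ - + 1 [ p ]
    conclude (k , _ , product≋) = ≋-trans {b = + (2 ℕ.+ n) * + (suc n !)} (≋-reflexive (ℤₚ.pos-* (2 ℕ.+ n) (suc n !)))
      (≋-* {a = + (2 ℕ.+ n)} {b = - + 1} {c = + (suc n !)} {d = + 1} p-1
        (subst (λ t → + t ≋ + 1 [ p ]) (product-range-2 n) (subst (+ product middle ≋_[ p ]) (ℤₚ.^-zeroˡ k) product≋)))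

-- The quadratic character of −2

-- The Kronecker symbol (−2/·).
χ : ℕ → ℤ
χ 1 = + 1
χ 3 = + 1
χ 5 = - + 1
χ 7 = - + 1
χ (suc (suc (suc (suc (suc (suc (suc (suc n)))))))) = χ n
χ _ = + 0

χ-+8* : ∀ q r → χ (r ℕ.+ q ℕ.* 8) ≡ χ r
χ-+8* zero    r = cong χ (ℕₚ.+-identityʳ r)
χ-+8* (suc q) r = trans (cong χ (regroup r (q ℕ.* 8))) (χ-+8* q r)
  where
  regroup : ∀ r t → r ℕ.+ (8 ℕ.+ t) ≡ 8 ℕ.+ (r ℕ.+ t)
  regroup = ℕ-Solver.solve-∀

mod-8 : ∀ n → ∃₂ λ (r : Fin 8) q → n ≡ toℕ r ℕ.+ q ℕ.* 8
mod-8 n = fromℕ< (ℕ%.m%n<n n 8) , n ℕ%./ 8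
  , trans (ℕ%.m≡m%n+[m/n]*n n 8) (cong (ℕ._+ n ℕ%./ 8 ℕ.* 8) (sym (Finₚ.toℕ-fromℕ< (ℕ%.m%n<n n 8))))

-- Periodicity reduces multiplicativity to 64 pairs of residues, which are decided by evaluation.
χ-* : ∀ m n → χ (m ℕ.* n) ≡ χ m * χ n
χ-* m n with mod-8 m | mod-8 n
... | r , q , refl | s , t , refl = begin
  χ ((toℕ r ℕ.+ q ℕ.* 8) ℕ.* (toℕ s ℕ.+ t ℕ.* 8))  ≡⟨ cong χ (expand (toℕ r) q (toℕ s) t) ⟩
  χ (toℕ r ℕ.* toℕ s ℕ.+ (q ℕ.* (toℕ s ℕ.+ t ℕ.* 8) ℕ.+ toℕ r ℕ.* t) ℕ.* 8)
    ≡⟨ χ-+8* (q ℕ.* (toℕ s ℕ.+ t ℕ.* 8) ℕ.+ toℕ r ℕ.* t) (toℕ r ℕ.* toℕ s) ⟩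
  χ (toℕ r ℕ.* toℕ s)                               ≡⟨ table r s ⟩
  χ (toℕ r) * χ (toℕ s)                             ≡⟨ cong₂ _*_ (χ-+8* q (toℕ r)) (χ-+8* t (toℕ s)) ⟨
  χ (toℕ r ℕ.+ q ℕ.* 8) * χ (toℕ s ℕ.+ t ℕ.* 8)   ∎
  where
  open ≡-Reasoning
  expand : ∀ r q s t → (r ℕ.+ q ℕ.* 8) ℕ.* (s ℕ.+ t ℕ.* 8) ≡ r ℕ.* s ℕ.+ (q ℕ.* (s ℕ.+ t ℕ.* 8) ℕ.+ r ℕ.* t) ℕ.* 8
  expand = ℕ-Solver.solve-∀
  table : ∀ (r s : Fin 8) → χ (toℕ r ℕ.* toℕ s) ≡ χ (toℕ r) * χ (toℕ s)
  table = from-yes (Finₚ.all? λ (r : Fin 8) → Finₚ.all? λ (s : Fin 8) → χ (toℕ r ℕ.* toℕ s) ℤₚ.≟ χ (toℕ r) * χ (toℕ s))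

χ-form : ∀ m n → χ (m ℕ.* m ℕ.+ 2 ℕ.* (n ℕ.* n)) ≡ + 0 ⊎ χ (m ℕ.* m ℕ.+ 2 ℕ.* (n ℕ.* n)) ≡ + 1
χ-form m n with mod-8 m | mod-8 n
... | r , q , refl | s , t , refl = subst (λ z → z ≡ + 0 ⊎ z ≡ + 1)
  (sym (trans (cong χ (expand (toℕ r) q (toℕ s) t))
    (χ-+8* (2 ℕ.* toℕ r ℕ.* q ℕ.+ q ℕ.* q ℕ.* 8 ℕ.+ 2 ℕ.* (2 ℕ.* toℕ s ℕ.* t ℕ.+ t ℕ.* t ℕ.* 8))
      (toℕ r ℕ.* toℕ r ℕ.+ 2 ℕ.* (toℕ s ℕ.* toℕ s))))) (table r s)
  where
  expand : ∀ r q s t → (r ℕ.+ q ℕ.* 8) ℕ.* (r ℕ.+ q ℕ.* 8) ℕ.+ 2 ℕ.* ((s ℕ.+ t ℕ.* 8) ℕ.* (s ℕ.+ t ℕ.* 8))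
    ≡ r ℕ.* r ℕ.+ 2 ℕ.* (s ℕ.* s) ℕ.+ (2 ℕ.* r ℕ.* q ℕ.+ q ℕ.* q ℕ.* 8 ℕ.+ 2 ℕ.* (2 ℕ.* s ℕ.* t ℕ.+ t ℕ.* t ℕ.* 8)) ℕ.* 8
  expand = ℕ-Solver.solve-∀
  table : ∀ (r s : Fin 8) → χ (toℕ r ℕ.* toℕ r ℕ.+ 2 ℕ.* (toℕ s ℕ.* toℕ s)) ≡ + 0
                          ⊎ χ (toℕ r ℕ.* toℕ r ℕ.+ 2 ℕ.* (toℕ s ℕ.* toℕ s)) ≡ + 1
  table = from-yes (Finₚ.all? λ (r : Fin 8) → Finₚ.all? λ (s : Fin 8) →
    (χ (toℕ r ℕ.* toℕ r ℕ.+ 2 ℕ.* (toℕ s ℕ.* toℕ s)) ℤₚ.≟ + 0) ⊎-dec (χ (toℕ r ℕ.* toℕ r ℕ.+ 2 ℕ.* (toℕ s ℕ.* toℕ s)) ℤₚ.≟ + 1))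

χ≡0⇒even : ∀ n → χ n ≡ + 0 → 2 ℕ∣.∣ n
χ≡0⇒even 0 _ = ℕ∣.divides 0 refl
χ≡0⇒even 2 _ = ℕ∣.divides 1 refl
χ≡0⇒even 4 _ = ℕ∣.divides 2 refl
χ≡0⇒even 6 _ = ℕ∣.divides 3 refl
χ≡0⇒even (suc (suc (suc (suc (suc (suc (suc (suc n)))))))) χ≡0 = ℕ∣.∣m∣n⇒∣m+n (ℕ∣.divides 4 refl) (χ≡0⇒even n χ≡0)

data Unit-or-zero : ℤ → Set where
  zero     : Unit-or-zero (+ 0)
  positive : Unit-or-zero (+ 1)
  negative : Unit-or-zero (- + 1)

χ-value : ∀ n → Unit-or-zero (χ n)
χ-value 0 = zero
χ-value 1 = positive
χ-value 2 = zero
χ-value 3 = positive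
χ-value 4 = zero
χ-value 5 = negative
χ-value 6 = zero
χ-value 7 = negative
χ-value (suc (suc (suc (suc (suc (suc (suc (suc n)))))))) = χ-value n

χ≡1⇒mod-8 : ∀ n → χ n ≡ + 1 → (∃ λ k → n ≡ 1 ℕ.+ k ℕ.* 8) ⊎ (∃ λ k → n ≡ 3 ℕ.+ k ℕ.* 8)
χ≡1⇒mod-8 1 _ = inj₁ (0 , refl)
χ≡1⇒mod-8 3 _ = inj₂ (0 , refl)
χ≡1⇒mod-8 (suc (suc (suc (suc (suc (suc (suc (suc n)))))))) χ≡1 with χ≡1⇒mod-8 n χ≡1
... | inj₁ (k , refl) = inj₁ (suc k , refl)
... | inj₂ (k , refl) = inj₂ (suc k , refl)

-- The double factorial (2v - 1)!! = 1 · 3 ⋯ (2v - 1).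
odds : ℕ → ℤ
odds zero    = + 1
odds (suc v) = odds v * (+ 2 * + v + + 1)

-- The falling factorial h (h - 1) ⋯ (h - v + 1), which for v ≤ h is the product of the upper v of
-- the numbers 1, ..., h.
falling : ℕ → ℕ → ℤ
falling h zero    = + 1
falling h (suc v) = falling h v * (+ h - + v)

falling-factorial : ∀ u v → falling (u ℕ.+ v) v * + (u !) ≡ + ((u ℕ.+ v) !)
falling-factorial u zero = trans (ℤₚ.*-identityˡ (+ (u !))) (cong (λ n → + (n !)) (sym (ℕₚ.+-identityʳ u)))
falling-factorial u (suc v) = begin
  falling (u ℕ.+ suc v) v * (+ (u ℕ.+ suc v) - + v) * + (u !)
    ≡⟨ cong (λ h → falling h v * (+ h - + v) * + (u !)) (ℕₚ.+-suc u v) ⟩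
  falling (suc u ℕ.+ v) v * (+ suc u + + v - + v) * + (u !) ≡⟨ regroup (falling (suc u ℕ.+ v) v) (+ suc u) (+ v) (+ (u !)) ⟩
  falling (suc u ℕ.+ v) v * (+ suc u * + (u !))             ≡⟨ cong (falling (suc u ℕ.+ v) v *_) (ℤₚ.pos-* (suc u) (u !)) ⟨
  falling (suc u ℕ.+ v) v * + (suc u !)                     ≡⟨ falling-factorial (suc u) v ⟩
  + ((suc u ℕ.+ v) !)                                       ≡⟨ cong (λ n → + (n !)) (ℕₚ.+-suc u v) ⟨
  + ((u ℕ.+ suc v) !)                                       ∎
  where
  open ≡-Reasoning
  regroup : ∀ f a v b → f * (a + v - v) * b ≡ f * (a * b)
  regroup = solve-∀

-- The even factors give 2^u u!, the odd ones (2u - 1)!!. This and `factorial-odd` supply the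
-- hypothesis on h! in `gauss`.
factorial-even : ∀ u → + ((u ℕ.+ u) !) ≡ (+ 2) ^ u * + (u !) * odds u
factorial-even zero    = refl
factorial-even (suc u) = begin
  + ((suc u ℕ.+ suc u) !)                                          ≡⟨ cong (λ n → + (suc n !)) (ℕₚ.+-suc u u) ⟩
  + (suc (suc (u ℕ.+ u)) ℕ.* (suc (u ℕ.+ u) ℕ.* (u ℕ.+ u) !))    ≡⟨ trans (ℤₚ.pos-* (suc (suc (u ℕ.+ u))) (suc (u ℕ.+ u) ℕ.* (u ℕ.+ u) !)) (cong (+ suc (suc (u ℕ.+ u)) *_) (ℤₚ.pos-* (suc (u ℕ.+ u)) ((u ℕ.+ u) !))) ⟩
  (+ 2 + (+ u + + u)) * ((+ 1 + (+ u + + u)) * + ((u ℕ.+ u) !))   ≡⟨ cong (λ t → (+ 2 + (+ u + + u)) * ((+ 1 + (+ u + + u)) * t)) (factorial-even u) ⟩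
  (+ 2 + (+ u + + u)) * ((+ 1 + (+ u + + u)) * ((+ 2) ^ u * + (u !) * odds u)) ≡⟨ regroup (+ u) ((+ 2) ^ u) (+ (u !)) (odds u) ⟩
  + 2 * (+ 2) ^ u * ((+ 1 + + u) * + (u !)) * odds (suc u)         ≡⟨ cong (λ t → + 2 * (+ 2) ^ u * t * odds (suc u)) (ℤₚ.pos-* (suc u) (u !)) ⟨
  (+ 2) ^ suc u * + (suc u !) * odds (suc u)                       ∎
  where
  open ≡-Reasoning
  regroup : ∀ u e f o → (+ 2 + (u + u)) * ((+ 1 + (u + u)) * (e * f * o)) ≡ + 2 * e * ((+ 1 + u) * f) * (o * (+ 2 * u + + 1))
  regroup = solve-∀

factorial-odd : ∀ u → + ((u ℕ.+ suc u) !) ≡ (+ 2) ^ u * + (u !) * odds (suc u)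
factorial-odd u = begin
  + ((u ℕ.+ suc u) !)                                   ≡⟨ cong (λ n → + (n !)) (ℕₚ.+-suc u u) ⟩
  + (suc (u ℕ.+ u) ℕ.* (u ℕ.+ u) !)                    ≡⟨ ℤₚ.pos-* (suc (u ℕ.+ u)) ((u ℕ.+ u) !) ⟩
  (+ 1 + (+ u + + u)) * + ((u ℕ.+ u) !)                 ≡⟨ cong ((+ 1 + (+ u + + u)) *_) (factorial-even u) ⟩
  (+ 1 + (+ u + + u)) * ((+ 2) ^ u * + (u !) * odds u)  ≡⟨ regroup (+ u) ((+ 2) ^ u) (+ (u !)) (odds u) ⟩
  (+ 2) ^ u * + (u !) * odds (suc u)                    ∎
  where
  open ≡-Reasoning
  regroup : ∀ u e f o → (+ 1 + (u + u)) * (e * f * o) ≡ e * f * (o * (+ 2 * u + + 1))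
  regroup = solve-∀

-2^even : ∀ w → (- + 2) ^ (w ℕ.+ w) ≡ (+ 2) ^ (w ℕ.+ w)
-2^even w = begin
  (- + 2) ^ (w ℕ.+ w)         ≡⟨ ^-double (- + 2) ⟩
  ((- + 2) ^ 2) ^ w           ≡⟨⟩
  ((+ 2) ^ 2) ^ w             ≡⟨ ^-double (+ 2) ⟨
  (+ 2) ^ (w ℕ.+ w)           ∎
  where
  open ≡-Reasoning
  ^-double : ∀ a → a ^ (w ℕ.+ w) ≡ (a ^ 2) ^ w
  ^-double a = trans (cong (a ^_) (cong (w ℕ.+_) (sym (ℕₚ.+-identityʳ w)))) (sym (ℤₚ.^-*-assoc a 2 w))

module _ {p : ℕ} (pr : Prime p) where

  ∤-factorial : ∀ n → n ℕ.< p → ¬ + p ∣ + (n !)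
  ∤-factorial zero    1≤p d = ∤-between (s≤s z≤n) (ℕ.nonTrivial⇒n>1 p {{prime⇒nonTrivial pr}}) d
  ∤-factorial (suc n) n<p d = ∤-* pr (+ suc n) (+ (n !)) (∤-between (s≤s z≤n) n<p) (∤-factorial n (ℕₚ.<⇒≤ n<p))
    (subst (+ p ∣_) (ℤₚ.pos-* (suc n) (n !)) d)

  -- Gauss's lemma for −2: the upper v of the residues 1, …, h become the odd numbers 1, 3, …, 2v − 1.
  -2*falling : ∀ h v → p ≡ suc (h ℕ.+ h) → (- + 2) ^ v * falling h v ≋ odds v [ p ]
  -2*falling h zero    p≡ = ≋-refl
  -2*falling h (suc v) p≡ =
    ≋-trans {b = (- + 2) ^ v * falling h v * (- + 2 * (+ h - + v))}
      (≋-reflexive (regroup ((- + 2) ^ v) (falling h v) (+ h - + v)))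
      (≋-* {a = (- + 2) ^ v * falling h v} {c = - + 2 * (+ h - + v)} (-2*falling h v p≡)
        (congruent (divides (- + 1) (trans (next-odd (+ h) (+ v)) (cong (λ t → - + 1 * + t) (sym p≡))))))
    where
    regroup : ∀ e f d → - + 2 * e * (f * d) ≡ e * f * (- + 2 * d)
    regroup = solve-∀
    next-odd : ∀ h v → - + 2 * (h - v) - (+ 2 * v + + 1) ≡ - + 1 * (+ 1 + (h + h))
    next-odd = solve-∀

  -- In h! (-2)^h the lower u = 2w residues contribute (-2)^u u! = 2^u u!, the sign vanishing
  -- because u is even, and the upper v contribute the odd numbers below 2v. Together these are
  -- again the factors of h!, which is prime to p and cancels.
  gauss : ∀ w v → let h = w ℕ.+ w ℕ.+ v in p ≡ suc (h ℕ.+ h) →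
    + (h !) ≡ (+ 2) ^ (w ℕ.+ w) * + ((w ℕ.+ w) !) * odds v → (- + 2) ^ h ≋ + 1 [ p ]
  gauss w v p≡ h!≡ = ≋-cancelˡ pr (+ (h !)) {(- + 2) ^ h} {+ 1} (∤-factorial h h<p)
    (≋-trans (≋-reflexive split) (≋-trans
      (≋-* {a = (+ 2) ^ u * + (u !)} {c = (- + 2) ^ v * falling h v} ≋-refl (-2*falling h v p≡))
      (≋-reflexive (trans (sym h!≡) (sym (ℤₚ.*-identityʳ (+ (h !))))))))
    where
    open ≡-Reasoning
    u h : ℕ
    u = w ℕ.+ w
    h = u ℕ.+ v
    h<p : h ℕ.< p
    h<p = subst (h ℕ.<_) (sym p≡) (s≤s (ℕₚ.m≤m+n h h))
    split : + (h !) * (- + 2) ^ h ≡ (+ 2) ^ u * + (u !) * ((- + 2) ^ v * falling h v)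
    split = begin
      + (h !) * (- + 2) ^ h                                     ≡⟨ cong₂ _*_ (sym (falling-factorial u v)) (ℤₚ.^-distribˡ-+-* (- + 2) u v) ⟩
      falling h v * + (u !) * ((- + 2) ^ u * (- + 2) ^ v)       ≡⟨ cong (λ t → falling h v * + (u !) * (t * (- + 2) ^ v)) (-2^even w) ⟩
      falling h v * + (u !) * ((+ 2) ^ u * (- + 2) ^ v)         ≡⟨ regroup (falling h v) (+ (u !)) ((+ 2) ^ u) ((- + 2) ^ v) ⟩
      (+ 2) ^ u * + (u !) * ((- + 2) ^ v * falling h v)         ∎
      where
      regroup : ∀ a b c d → a * b * (c * d) ≡ c * b * (d * a)
      regroup = solve-∀

  -- The two evaluations of (p - 1)! would give p ∣ 1 - (-1) = 2, while p ≥ 3.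
  euler : ∀ h → p ≡ suc (h ℕ.+ h) → 1 ≤ℕ h → (- + 2) ^ h ≋ + 1 [ p ] → ¬ (∀ x → ¬ (+ x * + x ≋ - + 2 [ p ]))
  euler h@(suc g) p≡ _ power nonresidue = ∤-between {p} (s≤s z≤n) 2<p
    (difference (≋-trans {b = + ((h ℕ.+ h) !)} (≋-sym (≋-trans (nonresidue-factorial pr (- + 2) h p≡ p∤2 nonresidue) power))
      (subst (λ n → + (n !) ≋ - + 1 [ p ]) (sym h+h≡) (wilson pr (g ℕ.+ g) (trans p≡ (cong suc h+h≡))))))
    where
    h+h≡ : h ℕ.+ h ≡ 2 ℕ.+ (g ℕ.+ g)
    h+h≡ = cong suc (ℕₚ.+-suc g g)
    2<p : 2 ℕ.< p
    2<p = subst (2 ℕ.<_) (sym (trans p≡ (cong suc h+h≡))) (s≤s (s≤s (s≤s z≤n)))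
    p∤2 : ¬ + p ∣ - + 2
    p∤2 d = ∤-between {p} (s≤s z≤n) 2<p (∣m⇒∣-m d)

  -- A double negation suffices: `nonresidue⇒χ≡-1` uses it only to exclude χ p = 1 once the search
  -- for a root has failed.
  χ≡1⇒¬nonresidue : χ p ≡ + 1 → ¬ (∀ x → ¬ (+ x * + x ≋ - + 2 [ p ]))
  χ≡1⇒¬nonresidue χ≡1 with χ≡1⇒mod-8 p χ≡1
  ... | inj₁ (zero  , refl) = ⊥-elim (¬prime[1] pr)
  -- p = 8k + 1 has h = 4k = 2k + 2k, and p = 8k + 3 below has h = 4k + 1 = 2k + (2k + 1). In both,
  -- the lower part 2k is even, as `gauss` demands.
  ... | inj₁ (k@(suc _) , p≡) = euler h p≡′ (s≤s z≤n) (gauss k (k ℕ.+ k) p≡′ (factorial-even (k ℕ.+ k)))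
    where
    h : ℕ
    h = k ℕ.+ k ℕ.+ (k ℕ.+ k)
    p≡′ : p ≡ suc (h ℕ.+ h)
    p≡′ = trans p≡ (octuple k)
      where
      octuple : ∀ k → 1 ℕ.+ k ℕ.* 8 ≡ suc (k ℕ.+ k ℕ.+ (k ℕ.+ k) ℕ.+ (k ℕ.+ k ℕ.+ (k ℕ.+ k)))
      octuple = ℕ-Solver.solve-∀
  ... | inj₂ (k , p≡) = euler h p≡′ (ℕₚ.≤-trans (s≤s z≤n) (ℕₚ.m≤n+m (suc (k ℕ.+ k)) (k ℕ.+ k)))
      (gauss k (suc (k ℕ.+ k)) p≡′ (factorial-odd (k ℕ.+ k)))
    where
    h : ℕ
    h = k ℕ.+ k ℕ.+ suc (k ℕ.+ k)
    p≡′ : p ≡ suc (h ℕ.+ h)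
    p≡′ = trans p≡ (octuple k)
      where
      octuple : ∀ k → 3 ℕ.+ k ℕ.* 8 ≡ suc (k ℕ.+ k ℕ.+ suc (k ℕ.+ k) ℕ.+ (k ℕ.+ k ℕ.+ suc (k ℕ.+ k)))
      octuple = ℕ-Solver.solve-∀

-- Representation numbers and multiplication by elements of prime norm

enumerate : ∀ n {Q : ℤ × ℤ → Set} → Decidable Q → (∀ α → Q α → norm α ℤ.≤ + n) → Enumeration Q
enumerate n {Q} Q? bounded = record
  { elements = elements
  ; unique   = unique
  ; complete = λ α → mk⇔
      (λ α∈ → proj₂ (sound (restrict (ellipse n) Q?) α∈))
      (λ Qα → member (restrict (ellipse n) Q?) (subst (ℤ._≤ + n) (norm≡^ (proj₁ α) (proj₂ α)) (bounded α Qα) , Qα))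
  }
  where open Enumeration (restrict (ellipse n) Q?)

reps : ∀ n → Enumeration (λ α → norm α ≡ + n)
reps n = enumerate n (λ α → norm α ℤₚ.≟ + n) (λ _ → ℤₚ.≤-reflexive)

-- p · norm α = n encodes norm α = n/p, with no solutions if p ∤ n.
reps/ : ∀ p .{{_ : NonZero p}} n → Enumeration (λ α → + p * norm α ≡ + n)
reps/ p n = enumerate n (λ α → + p * norm α ℤₚ.≟ + n) bounded
  where
  bounded : ∀ α → + p * norm α ≡ + n → norm α ℤ.≤ + n
  bounded (x , y) eq rewrite norm≡ x y = +≤+ (ℕₚ.≤-trans (ℕₚ.m≤n*m _ p) (ℕₚ.≤-reflexive (ℤₚ.+-injective (trans (ℤₚ.pos-* p _) eq))))

r : ℕ → ℕ
r n = # (reps n)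

r/ : ∀ p .{{_ : NonZero p}} → ℕ → ℕ
r/ p n = # (reps/ p n)

-- The ramified prime: x² + 2y² is even only if x is, and then √-2 divides x + y√-2.
r-double : ∀ n → r (2 ℕ.* n) ≡ r n
r-double n = sym (#-bijection (reps n) (reps (2 ℕ.* n)) f (λ {α} → preserves {α}) injective surjective)
  where
  f : ℤ × ℤ → ℤ × ℤ
  -- This is √-2 times the conjugate of x + y√-2; conjugating first avoids a sign.
  f (x , y) = + 2 * y , x
  norm-f : ∀ x y → + 2 * y * (+ 2 * y) + + 2 * (x * x) ≡ + 2 * (x * x + + 2 * (y * y))
  norm-f = solve-∀
  preserves : ∀ {α} → norm α ≡ + n → norm (f α) ≡ + (2 ℕ.* n)
  preserves {x , y} eq = trans (norm-f x y) (trans (cong (+ 2 *_) eq) (sym (ℤₚ.pos-* 2 n)))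
  injective : ∀ {α β} → f α ≡ f β → α ≡ β
  injective {x , y} {x′ , y′} eq = cong₂ _,_ (cong proj₂ eq) (ℤₚ.*-cancelˡ-≡ (+ 2) y y′ (cong proj₁ eq))
  surjective : ∀ {β} → norm β ≡ + (2 ℕ.* n) → ∃ λ α → norm α ≡ + n × β ≡ f α
  surjective {x , y} eq = halve (prime-∣-* prime[2] x x 2∣x²)
    where
    2∣x² : + 2 ∣ x * x
    2∣x² = subst (+ 2 ∣_) (cancel (x * x) (+ 2 * (y * y)))
      (∣m∣n⇒∣m-n (subst (+ 2 ∣_) (sym eq) (divides (+ n) (trans (ℤₚ.pos-* 2 n) (ℤₚ.*-comm (+ 2) (+ n))))) (divides (y * y) (ℤₚ.*-comm (+ 2) (y * y))))
      where
      cancel : ∀ a b → a + b - b ≡ a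
      cancel = solve-∀
    half : + 2 ∣ x → ∃ λ α → norm α ≡ + n × (x , y) ≡ f α
    half (divides q x≡) = (y , q) , ℤₚ.*-cancelˡ-≡ (+ 2) _ _ (trans (sym (norm-f y q)) (trans (cong (λ t → norm (t , y)) (sym x≡2q)) (trans eq (ℤₚ.pos-* 2 n)))) , cong (_, y) x≡2q
      where
      x≡2q : x ≡ + 2 * q
      x≡2q = trans x≡ (ℤₚ.*-comm q (+ 2))
    halve : (+ 2 ∣ x) ⊎ (+ 2 ∣ x) → ∃ λ α → norm α ≡ + n × (x , y) ≡ f α
    halve (inj₁ d) = half d
    halve (inj₂ d) = half d

conj-⊗-⊗ : ∀ π α → conj π ⊗ (π ⊗ α) ≡ (norm π * proj₁ α , norm π * proj₂ α)
conj-⊗-⊗ (a , b) (x , y) = cong₂ _,_ (first a b x y) (second a b x y)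
  where
  first : ∀ a b x y → a * (a * x - + 2 * (b * y)) - + 2 * (- b * (a * y + b * x)) ≡ (a * a + + 2 * (b * b)) * x
  first = solve-∀
  second : ∀ a b x y → a * (a * y + b * x) + - b * (a * x - + 2 * (b * y)) ≡ (a * a + + 2 * (b * b)) * y
  second = solve-∀

module _ {p : ℕ} (pr : Prime p) where

  private instance
    p-nonZero : NonZero p
    p-nonZero = prime⇒nonZero pr

  prime-∣-square : ∀ x → + p ∣ x * x → + p ∣ x
  prime-∣-square x d with prime-∣-* pr x x d
  ... | inj₁ d′ = d′
  ... | inj₂ d′ = d′

  -- If p divides a norm only together with both coordinates, the elements of norm p n are exactly p
  -- times those of norm n/p.
  r-inert : (∀ x y → + p ∣ norm (x , y) → + p ∣ y) → ∀ n → r (p ℕ.* n) ≡ r/ p n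
  r-inert inert n = sym (#-bijection (reps/ p n) (reps (p ℕ.* n)) f preserves injective surjective)
    where
    f : ℤ × ℤ → ℤ × ℤ
    f (x , y) = + p * x , + p * y
    norm-f : ∀ p x y → p * x * (p * x) + + 2 * (p * y * (p * y)) ≡ p * (p * (x * x + + 2 * (y * y)))
    norm-f = solve-∀
    preserves : ∀ {α} → + p * norm α ≡ + n → norm (f α) ≡ + (p ℕ.* n)
    preserves {x , y} eq = trans (norm-f (+ p) x y) (trans (cong (+ p *_) eq) (sym (ℤₚ.pos-* p n)))
    injective : ∀ {α β} → f α ≡ f β → α ≡ β
    injective {x , y} {x′ , y′} eq = cong₂ _,_ (ℤₚ.*-cancelˡ-≡ (+ p) x x′ (cong proj₁ eq)) (ℤₚ.*-cancelˡ-≡ (+ p) y y′ (cong proj₂ eq))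
    surjective : ∀ {β} → norm β ≡ + (p ℕ.* n) → ∃ λ α → + p * norm α ≡ + n × β ≡ f α
    surjective {x , y} eq = divided p∣x p∣y
      where
      p∣norm : + p ∣ norm (x , y)
      p∣norm = divides (+ n) (trans eq (trans (ℤₚ.pos-* p n) (ℤₚ.*-comm (+ p) (+ n))))
      p∣y : + p ∣ y
      p∣y = inert x y p∣norm
      p∣x : + p ∣ x
      p∣x = prime-∣-square x (∣m+n∣n⇒∣m p∣norm (∣n⇒∣m*n (+ 2) (∣m⇒∣m*n y p∣y)))
      divided : + p ∣ x → + p ∣ y → ∃ λ α → + p * norm α ≡ + n × (x , y) ≡ f α
      divided (divides q x≡) (divides s y≡) = (q , s)
        , ℤₚ.*-cancelˡ-≡ (+ p) _ _ (trans (sym (norm-f (+ p) q s)) (trans (cong norm (sym xy≡)) (trans eq (ℤₚ.pos-* p n))))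
        , xy≡
        where
        xy≡ : (x , y) ≡ f (q , s)
        xy≡ = cong₂ _,_ (trans x≡ (ℤₚ.*-comm q (+ p))) (trans y≡ (ℤₚ.*-comm s (+ p)))

  -- p ∣ b would give p ∣ a, and then p² ∣ p.
  norm⇒∤ : ∀ a b → norm (a , b) ≡ + p → ¬ + p ∣ b
  norm⇒∤ a b norm≡p p∣b = contradictory p∣a p∣b
    where
    p∣a : + p ∣ a
    p∣a = prime-∣-square a (∣m+n∣n⇒∣m (subst (+ p ∣_) (sym norm≡p) ∣-refl) (∣n⇒∣m*n (+ 2) (∣m⇒∣m*n b p∣b)))
    contradictory : + p ∣ a → + p ∣ b → ⊥
    contradictory (divides q refl) (divides s refl) =
      ∤-between (s≤s z≤n) (ℕ.nonTrivial⇒n>1 p {{prime⇒nonTrivial pr}})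
        (divides (q * q + + 2 * (s * s)) (ℤₚ.*-cancelˡ-≡ (+ p) (+ 1) _ (trans (ℤₚ.*-identityʳ (+ p)) (trans (sym norm≡p) (factor q s (+ p))))))
      where
      factor : ∀ q s p → q * p * (q * p) + + 2 * (s * p * (s * p)) ≡ p * ((q * q + + 2 * (s * s)) * p)
      factor = solve-∀

  ⊗-injective : ∀ π {α β} → norm π ≡ + p → π ⊗ α ≡ π ⊗ β → α ≡ β
  ⊗-injective π {α} {β} norm≡p eq = cong₂ _,_ (cancel (cong proj₁ scaled)) (cancel (cong proj₂ scaled))
    where
    scaled : (norm π * proj₁ α , norm π * proj₂ α) ≡ (norm π * proj₁ β , norm π * proj₂ β)
    scaled = trans (sym (conj-⊗-⊗ π α)) (trans (cong (conj π ⊗_) eq) (conj-⊗-⊗ π β))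
    cancel : ∀ {x y} → norm π * x ≡ norm π * y → x ≡ y
    cancel {x} {y} e = ℤₚ.*-cancelˡ-≡ (+ p) x y (subst (λ t → t * x ≡ t * y) norm≡p e)

  -- The condition p ∣ a y − b x says that a + b √−2 divides x + y √−2.
  ⊗-divisible : ∀ a b → norm (a , b) ≡ + p → ∀ x y → + p ∣ a * y - b * x → ∃ λ β → (x , y) ≡ (a , b) ⊗ β
  ⊗-divisible a b norm≡p x y p∣ = quotients p∣re p∣
    where
    -- The conjugate of a + b√-2 times x + y√-2 has coordinates a x + 2 b y and a y - b x.
    -- Divisibility of the second passes to the first because p ∤ b; dividing both by p gives the
    -- quotient.
    p∣re : + p ∣ a * x + + 2 * (b * y)
    p∣re = prime-∣-cancelˡ pr b (norm⇒∤ a b norm≡p)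
      (subst (+ p ∣_) (combine a b x y) (∣m∣n⇒∣m-n (∣m⇒∣m*n y (subst (+ p ∣_) (sym norm≡p) ∣-refl)) (∣n⇒∣m*n a p∣)))
      where
      combine : ∀ a b x y → (a * a + + 2 * (b * b)) * y - a * (a * y - b * x) ≡ b * (a * x + + 2 * (b * y))
      combine = solve-∀
    quotients : + p ∣ a * x + + 2 * (b * y) → + p ∣ a * y - b * x → ∃ λ β → (x , y) ≡ (a , b) ⊗ β
    quotients (divides u u≡) (divides v v≡) = (u , v) , cong₂ _,_
      (ℤₚ.*-cancelˡ-≡ (+ p) _ _ (trans (cong (_* x) (sym norm≡p)) (trans (first a b x y) (trans (cong₂ (λ s t → a * s - + 2 * (b * t)) u≡ v≡) (first′ a b u v (+ p))))))
      (ℤₚ.*-cancelˡ-≡ (+ p) _ _ (trans (cong (_* y) (sym norm≡p)) (trans (second a b x y) (trans (cong₂ (λ s t → a * t + b * s) u≡ v≡) (second′ a b u v (+ p))))))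
      where
      first : ∀ a b x y → (a * a + + 2 * (b * b)) * x ≡ a * (a * x + + 2 * (b * y)) - + 2 * (b * (a * y - b * x))
      first = solve-∀
      first′ : ∀ a b u v p → a * (u * p) - + 2 * (b * (v * p)) ≡ p * (a * u - + 2 * (b * v))
      first′ = solve-∀
      second : ∀ a b x y → (a * a + + 2 * (b * b)) * y ≡ a * (a * y - b * x) + b * (a * x + + 2 * (b * y))
      second = solve-∀
      second′ : ∀ a b u v p → a * (v * p) + b * (u * p) ≡ p * (a * v + b * u)
      second′ = solve-∀

  module _ (a b : ℤ) (norm≡p : norm (a , b) ≡ + p) (p∤2 : ¬ + p ∣ + 2) (n : ℕ) where
    private
      π π̄ : ℤ × ℤ
      π = a , b
      π̄ = conj π

      norm-π̄ : norm π̄ ≡ + p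
      norm-π̄ = trans (norm-conj π) norm≡p

      p∤a : ¬ + p ∣ a
      p∤a p∣a = ∤-* pr (+ 2) (b * b) p∤2 (∤-* pr b b p∤b p∤b)
        (∣m+n∣m⇒∣n (subst (+ p ∣_) (sym norm≡p) ∣-refl) (∣m⇒∣m*n a p∣a))
        where
        p∤b : ¬ + p ∣ b
        p∤b = norm⇒∤ a b norm≡p

      π∣_ : ℤ × ℤ → Set
      π∣ (x , y) = + p ∣ a * y - b * x

      π∣? : Decidable π∣_
      π∣? (x , y) = + p ∣? (a * y - b * x)

      π∣π⊗ : ∀ α → π∣ (π ⊗ α)
      π∣π⊗ (x , y) = divides y (trans (factor a b x y) (trans (cong (_* y) norm≡p) (ℤₚ.*-comm (+ p) y)))
        where
        factor : ∀ a b x y → a * (a * y + b * x) - b * (a * x - + 2 * (b * y)) ≡ (a * a + + 2 * (b * b)) * y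
        factor = solve-∀

      norm-⊗-p : ∀ ρ {α} m → norm ρ ≡ + p → norm (ρ ⊗ α) ≡ + p * m → norm α ≡ m
      norm-⊗-p ρ {α} m normρ eq = ℤₚ.*-cancelˡ-≡ (+ p) (norm α) m (trans (cong (_* norm α) (sym normρ)) (trans (sym (norm-⊗ ρ α)) eq))

      p* : ∀ ρ {α} → norm ρ ≡ + p → norm α ≡ + n → norm (ρ ⊗ α) ≡ + (p ℕ.* n)
      p* ρ {α} normρ eq = trans (norm-⊗ ρ α) (trans (cong₂ _*_ normρ eq) (sym (ℤₚ.pos-* p n)))

    private
      -- A refers to the elements of norm p n and B to those of norm n; the intersections are the
      -- parts divisible by π.
      A∩ : # (restrict (reps (p ℕ.* n)) π∣?) ≡ r n
      A∩ = sym (#-bijection (reps n) (restrict (reps (p ℕ.* n)) π∣?) (π ⊗_)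
        (λ {α} eq → p* π {α} norm≡p eq , π∣π⊗ α) (⊗-injective π norm≡p)
        (λ {α} (eq , d) → preimage α eq (⊗-divisible a b norm≡p (proj₁ α) (proj₂ α) d)))
        where
        preimage : ∀ α → norm α ≡ + (p ℕ.* n) → ∃ (λ β → α ≡ π ⊗ β) → ∃ λ β → norm β ≡ + n × α ≡ π ⊗ β
        preimage _ eq (β , refl) = β , norm-⊗-p π {β} (+ n) norm≡p (trans eq (ℤₚ.pos-* p n)) , refl

      B∩ : # (restrict (reps n) π∣?) ≡ r/ p n
      B∩ = sym (#-bijection (reps/ p n) (restrict (reps n) π∣?) (π ⊗_)
        (λ {α} eq → trans (norm-⊗ π α) (trans (cong (_* norm α) norm≡p) eq) , π∣π⊗ α) (⊗-injective π norm≡p)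
        (λ {α} (eq , d) → preimage α eq (⊗-divisible a b norm≡p (proj₁ α) (proj₂ α) d)))
        where
        preimage : ∀ α → norm α ≡ + n → ∃ (λ β → α ≡ π ⊗ β) → ∃ λ β → + p * norm β ≡ + n × α ≡ π ⊗ β
        preimage _ eq (β , refl) = β , trans (cong (_* norm β) (sym norm≡p)) (trans (sym (norm-⊗ π β)) eq) , refl

      -- Modulo π the conjugate 2a - π is the integer 2a, which is prime to p because p ∤ 2 and p ∤
      -- a.
      π∣π̄⊗⇒ : ∀ α → π∣ (π̄ ⊗ α) → π∣ α
      π∣π̄⊗⇒ (x , y) d = prime-∣-cancelˡ pr (+ 2 * a) (∤-* pr (+ 2) a p∤2 p∤a)
        (subst (+ p ∣_) (combine a b x y) (∣m∣n⇒∣m+n d (∣m⇒∣m*n y (subst (+ p ∣_) (sym norm≡p) ∣-refl))))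
        where
        combine : ∀ a b x y → a * (a * y + - b * x) - b * (a * x - + 2 * (- b * y)) + (a * a + + 2 * (b * b)) * y ≡ + 2 * a * (a * y - b * x)
        combine = solve-∀

      ⇒π∣π̄⊗ : ∀ α → π∣ α → π∣ (π̄ ⊗ α)
      ⇒π∣π̄⊗ (x , y) d = subst (+ p ∣_) (combine a b x y) (∣m∣n⇒∣m-n (∣n⇒∣m*n (+ 2 * a) d) (∣m⇒∣m*n y (subst (+ p ∣_) (sym norm≡p) ∣-refl)))
        where
        combine : ∀ a b x y → + 2 * a * (a * y - b * x) - (a * a + + 2 * (b * b)) * y ≡ a * (a * y + - b * x) - b * (a * x - + 2 * (- b * y))
        combine = solve-∀

      -- The expressions testing divisibility by π and by its conjugate multiply to a²y² - b²x² =
      -- norm π · y² - b² · norm (x , y). So p divides one of them as soon as it divides the norm.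
      π̄-divides : ∀ x y → + p ∣ norm (x , y) → ¬ π∣ (x , y) → ∃ λ β → (x , y) ≡ π̄ ⊗ β
      π̄-divides x y p∣norm π∤ = ⊗-divisible a (- b) norm-π̄ x y (prime-∣-cancelˡ pr (a * y - b * x) π∤
        (subst (+ p ∣_) (combine a b x y) (∣m∣n⇒∣m-n (∣m⇒∣m*n (y * y) (subst (+ p ∣_) (sym norm≡p) ∣-refl)) (∣n⇒∣m*n (b * b) p∣norm))))
        where
        combine : ∀ a b x y → (a * a + + 2 * (b * b)) * (y * y) - b * b * (x * x + + 2 * (y * y)) ≡ (a * y - b * x) * (a * y - - b * x)
        combine = solve-∀

      A∖≡B∖ : # (restrict (reps (p ℕ.* n)) (¬? ∘ π∣?)) ≡ # (restrict (reps n) (¬? ∘ π∣?))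
      A∖≡B∖ = sym (#-bijection (restrict (reps n) (¬? ∘ π∣?)) (restrict (reps (p ℕ.* n)) (¬? ∘ π∣?)) (π̄ ⊗_)
        (λ {α} (eq , π∤) → p* π̄ {α} norm-π̄ eq , (λ d → π∤ (π∣π̄⊗⇒ α d))) (⊗-injective π̄ norm-π̄)
        (λ {α} (eq , π∤) → preimage α eq π∤ (π̄-divides (proj₁ α) (proj₂ α) (p∣norm α eq) π∤)))
        where
        p∣norm : ∀ α → norm α ≡ + (p ℕ.* n) → + p ∣ norm α
        p∣norm α eq = divides (+ n) (trans eq (trans (ℤₚ.pos-* p n) (ℤₚ.*-comm (+ p) (+ n))))
        preimage : ∀ α → norm α ≡ + (p ℕ.* n) → ¬ π∣ α → ∃ (λ β → α ≡ π̄ ⊗ β) →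
          ∃ λ β → (norm β ≡ + n × ¬ π∣ β) × α ≡ π̄ ⊗ β
        preimage _ eq π∤ (β , refl) = β , (norm-⊗-p π̄ {β} (+ n) norm-π̄ (trans eq (ℤₚ.pos-* p n)) , (λ d → π∤ (⇒π∣π̄⊗ β d))) , refl

    -- Elements of norm p n are divisible by π, or else by π̄, and multiplication by π̄ preserves
    -- and reflects divisibility by π.
    r-split : r (p ℕ.* n) ℕ.+ r/ p n ≡ r n ℕ.+ r n
    r-split = begin
      r (p ℕ.* n) ℕ.+ r/ p n        ≡⟨ cong (ℕ._+ r/ p n) A≡ ⟩
      r n ℕ.+ B∖ ℕ.+ r/ p n         ≡⟨ ℕₚ.+-assoc (r n) B∖ (r/ p n) ⟩
      r n ℕ.+ (B∖ ℕ.+ r/ p n)       ≡⟨ cong (r n ℕ.+_) (ℕₚ.+-comm B∖ (r/ p n)) ⟩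
      r n ℕ.+ (r/ p n ℕ.+ B∖)       ≡⟨ cong (r n ℕ.+_) B≡ ⟨
      r n ℕ.+ r n                   ∎
      where
      open ≡-Reasoning
      B∖ : ℕ
      B∖ = # (restrict (reps n) (¬? ∘ π∣?))
      A≡ : r (p ℕ.* n) ≡ r n ℕ.+ B∖
      A≡ = trans (#-split (reps (p ℕ.* n)) π∣?) (cong₂ ℕ._+_ A∩ A∖≡B∖)
      B≡ : r n ≡ r/ p n ℕ.+ B∖
      B≡ = trans (#-split (reps n) π∣?) (cong (ℕ._+ B∖) B∩)

-- The Hecke relation for representation numbers

module _ {p : ℕ} (pr : Prime p) where

  private instance
    nonZero-p : NonZero p
    nonZero-p = prime⇒nonZero pr

  -- Roots are sought in `Fin p`, which makes their existence decidable.
  Residue : Set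
  Residue = ∃ λ (i : Fin p) → + p ∣ + toℕ i * + toℕ i + + 2

  residue? : Dec Residue
  residue? = Finₚ.any? λ i → + p ∣? (+ toℕ i * + toℕ i + + 2)

  square+2⇒residue : ∀ z → + p ∣ z * z + + 2 → Residue
  square+2⇒residue z d = i , subst (λ t → + p ∣ + t * + t + + 2) (sym (Finₚ.toℕ-fromℕ< (ℤ%.n%ℕd<d z p)))
    (reduce z (+ (z ℤ%.%ℕ p)) (z ℤ%./ℕ p) (ℤ%.a≡a%ℕn+[a/ℕn]*n z p) d)
    where
    i : Fin p
    i = fromℕ< (ℤ%.n%ℕd<d z p)
    reduce : ∀ z r q → z ≡ r + q * + p → + p ∣ z * z + + 2 → + p ∣ r * r + + 2
    reduce _ r q refl d = subst (+ p ∣_) (expand r q (+ p)) (∣m∣n⇒∣m-n d (divides ((+ 2 * r + q * + p) * q) refl))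
      where
      expand : ∀ r q p → (r + q * p) * (r + q * p) + + 2 - (+ 2 * r + q * p) * q * p ≡ r * r + + 2
      expand = solve-∀

  -- If p ∤ y, dividing x² + 2y² ≡ 0 by y² makes x/y a square root of -2.
  nonresidue⇒inert : ¬ Residue → ∀ x y → + p ∣ norm (x , y) → + p ∣ y
  nonresidue⇒inert ¬res x y p∣norm with + p ∣? y
  ... | yes p∣y = p∣y
  ... | no  p∤y with inverse pr y p∤y
  ...   | z , d = ⊥-elim (¬res (square+2⇒residue (x * z) (subst (+ p ∣_) (expand x y z)
            (∣m∣n⇒∣m-n (∣n⇒∣m*n (z * z) p∣norm) (∣m⇒∣m*n (+ 2 * (y * z + + 1)) d)))))
    where
    expand : ∀ x y z → z * z * (x * x + + 2 * (y * y)) - (y * z - + 1) * (+ 2 * (y * z + + 1)) ≡ x * z * (x * z) + + 2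
    expand = solve-∀

  χ-odd-prime≢0 : p ≢ 2 → χ p ≢ + 0
  χ-odd-prime≢0 p≢2 χ≡0 with prime⇒irreducible pr (χ≡0⇒even p χ≡0)
  ... | inj₁ ()
  ... | inj₂ 2≡p = p≢2 (sym 2≡p)

  represented⇒χ≡1 : p ≢ 2 → Represented p → χ p ≡ + 1
  represented⇒χ≡1 p≢2 ((a , b) , eq) with χ-form ∣ a ∣ ∣ b ∣ | ℤₚ.+-injective (trans (sym eq) (norm≡ a b))
  ... | inj₁ χ≡0 | p≡ = ⊥-elim (χ-odd-prime≢0 p≢2 (trans (cong χ p≡) χ≡0))
  ... | inj₂ χ≡1 | p≡ = trans (cong χ p≡) χ≡1

  nonresidue⇒χ≡-1 : p ≢ 2 → ¬ Residue → χ p ≡ - + 1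
  nonresidue⇒χ≡-1 p≢2 ¬res = excluded (χ-value p) refl
    where
    excluded : ∀ {z} → Unit-or-zero z → χ p ≡ z → χ p ≡ - + 1
    excluded zero     χ≡ = ⊥-elim (χ-odd-prime≢0 p≢2 χ≡)
    excluded positive χ≡ = ⊥-elim (χ≡1⇒¬nonresidue pr χ≡ λ x xx → ¬res (square+2⇒residue (+ x) (difference xx)))
    excluded negative χ≡ = χ≡

  -- For χ p = 0, -1, 1 the relation reads r(pn) = r(n), r(pn) = r(n/p) and r(pn) + r(n/p) = 2r(n).
  hecke-r : ∀ n → + r (p ℕ.* n) + χ p * + r/ p n ≡ (+ 1 + χ p) * + r n
  hecke-r n with p ℕₚ.≟ 2
  ... | yes p≡2 = ramified (r (p ℕ.* n)) (r n) (r/ p n) (cong χ p≡2) (subst (λ q → r (q ℕ.* n) ≡ r n) (sym p≡2) (r-double n))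
    where
    ramified : ∀ a b c {z} → z ≡ + 0 → a ≡ b → + a + z * + c ≡ (+ 1 + z) * + b
    ramified a _ c refl refl = trans (ℤₚ.+-identityʳ (+ a)) (sym (ℤₚ.*-identityˡ (+ a)))
  ... | no p≢2 = odd residue?
    where
    p∤2 : ¬ + p ∣ + 2
    p∤2 = ∤-between (s≤s z≤n) (ℕₚ.≤∧≢⇒< (ℕ.nonTrivial⇒n>1 p {{prime⇒nonTrivial pr}}) (p≢2 ∘ sym))
    inert : ∀ a b c {z} → z ≡ - + 1 → a ≡ c → + a + z * + c ≡ (+ 1 + z) * + b
    inert a b _ refl refl = cancel (+ a) (+ b)
      where
      cancel : ∀ a b → a + - + 1 * a ≡ (+ 1 + - + 1) * b
      cancel = solve-∀
    split : ∀ a b c {z} → z ≡ + 1 → a ℕ.+ c ≡ b ℕ.+ b → + a + z * + c ≡ (+ 1 + z) * + b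
    split a b c refl eq = trans (cong (_+_ (+ a)) (ℤₚ.*-identityˡ (+ c))) (trans (cong +_ eq) (double (+ b)))
      where
      double : ∀ a → a + a ≡ (+ 1 + + 1) * a
      double = solve-∀
    represented : Represented p → + r (p ℕ.* n) + χ p * + r/ p n ≡ (+ 1 + χ p) * + r n
    represented ((a , b) , eq) = split (r (p ℕ.* n)) (r n) (r/ p n) (represented⇒χ≡1 p≢2 ((a , b) , eq)) (r-split pr a b eq p∤2 n)
    odd : Dec Residue → + r (p ℕ.* n) + χ p * + r/ p n ≡ (+ 1 + χ p) * + r n
    odd (yes (i , p∣)) = represented (residue⇒represented pr (+ toℕ i) p∣)
    odd (no ¬res)      = inert (r (p ℕ.* n)) (r n) (r/ p n) (nonresidue⇒χ≡-1 p≢2 ¬res) (r-inert pr (nonresidue⇒inert ¬res) n)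

-- Finite sums and the divisor sums of χ

∑ : ℕ → (ℕ → ℤ) → ℤ
∑ zero    f = + 0
∑ (suc n) f = ∑ n f + f (suc n)

∑-cong : ∀ n {f g : ℕ → ℤ} → (∀ i → 1 ≤ℕ i → i ≤ℕ n → f i ≡ g i) → ∑ n f ≡ ∑ n g
∑-cong zero    eq = refl
∑-cong (suc n) eq = cong₂ _+_ (∑-cong n λ i 1≤i i≤n → eq i 1≤i (ℕₚ.m≤n⇒m≤1+n i≤n)) (eq (suc n) (s≤s z≤n) ℕₚ.≤-refl)

∑-+ : ∀ n (f g : ℕ → ℤ) → ∑ n (λ i → f i + g i) ≡ ∑ n f + ∑ n g
∑-+ zero    f g = refl
∑-+ (suc n) f g = trans (cong (_+ (f (suc n) + g (suc n))) (∑-+ n f g)) (interchange (∑ n f) (∑ n g) (f (suc n)) (g (suc n)))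
  where
  interchange : ∀ a b c d → a + b + (c + d) ≡ a + c + (b + d)
  interchange = solve-∀

∑-* : ∀ n c (f : ℕ → ℤ) → ∑ n (λ i → c * f i) ≡ c * ∑ n f
∑-* zero    c f = sym (ℤₚ.*-zeroʳ c)
∑-* (suc n) c f = trans (cong (_+ c * f (suc n)) (∑-* n c f)) (sym (ℤₚ.*-distribˡ-+ c (∑ n f) (f (suc n))))

∑-const : ∀ n c → ∑ n (λ _ → c) ≡ + n * c
∑-const zero    c = refl
∑-const (suc n) c = trans (cong (_+ c) (∑-const n c)) (step (+ n) c)
  where
  step : ∀ n c → n * c + c ≡ (+ 1 + n) * c
  step = solve-∀

∑-zero : ∀ n {f} → (∀ i → 1 ≤ℕ i → i ≤ℕ n → f i ≡ + 0) → ∑ n f ≡ + 0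
∑-zero n f≡0 = trans (∑-cong n f≡0) (trans (∑-const n (+ 0)) (ℤₚ.*-zeroʳ (+ n)))

∑-swap : ∀ m n (f : ℕ → ℕ → ℤ) → ∑ m (λ i → ∑ n (f i)) ≡ ∑ n (λ j → ∑ m (λ i → f i j))
∑-swap zero    n f = sym (∑-zero n λ _ _ _ → refl)
∑-swap (suc m) n f = trans (cong (_+ ∑ n (f (suc m))) (∑-swap m n f)) (sym (∑-+ n (λ j → ∑ m (λ i → f i j)) (f (suc m))))

∑-split : ∀ m n (f : ℕ → ℤ) → ∑ (m ℕ.+ n) f ≡ ∑ m f + ∑ n (λ i → f (m ℕ.+ i))
∑-split m zero    f = trans (cong (λ t → ∑ t f) (ℕₚ.+-identityʳ m)) (sym (ℤₚ.+-identityʳ (∑ m f)))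
∑-split m (suc n) f = begin
  ∑ (m ℕ.+ suc n) f                                               ≡⟨ cong (λ t → ∑ t f) (ℕₚ.+-suc m n) ⟩
  ∑ (m ℕ.+ n) f + f (suc (m ℕ.+ n))                               ≡⟨ cong₂ (λ s t → s + f t) (∑-split m n f) (sym (ℕₚ.+-suc m n)) ⟩
  ∑ m f + ∑ n (λ i → f (m ℕ.+ i)) + f (m ℕ.+ suc n)               ≡⟨ ℤₚ.+-assoc (∑ m f) (∑ n (λ i → f (m ℕ.+ i))) (f (m ℕ.+ suc n)) ⟩
  ∑ m f + ∑ (suc n) (λ i → f (m ℕ.+ i))                           ∎
  where open ≡-Reasoning

∑-extend : ∀ {m n} (f : ℕ → ℤ) → m ≤ℕ n → (∀ i → m ℕ.< i → f i ≡ + 0) → ∑ n f ≡ ∑ m f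
∑-extend {m} {n} f m≤n f≡0 = begin
  ∑ n f                                        ≡⟨ cong (λ t → ∑ t f) (ℕₚ.m+[n∸m]≡n m≤n) ⟨
  ∑ (m ℕ.+ (n ℕ.∸ m)) f                        ≡⟨ ∑-split m (n ℕ.∸ m) f ⟩
  ∑ m f + ∑ (n ℕ.∸ m) (λ i → f (m ℕ.+ i))      ≡⟨ cong (_+_ (∑ m f)) (∑-zero (n ℕ.∸ m) λ i 1≤i _ → f≡0 (m ℕ.+ i) (ℕₚ.m<m+n m 1≤i)) ⟩
  ∑ m f + + 0                                  ≡⟨ ℤₚ.+-identityʳ (∑ m f) ⟩
  ∑ m f                                        ∎
  where open ≡-Reasoning

-- The Iverson bracket.
⟦_⟧ : ∀ {P : Set} → Dec P → ℤ
⟦ yes _ ⟧ = + 1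
⟦ no  _ ⟧ = + 0

⟦⟧-true : ∀ {P : Set} (P? : Dec P) → P → ⟦ P? ⟧ ≡ + 1
⟦⟧-true (yes _) _ = refl
⟦⟧-true (no ¬p) p = ⊥-elim (¬p p)

⟦⟧-false : ∀ {P : Set} (P? : Dec P) → ¬ P → ⟦ P? ⟧ ≡ + 0
⟦⟧-false (yes p) ¬p = ⊥-elim (¬p p)
⟦⟧-false (no _)  _  = refl

⟦⟧-cong : ∀ {P Q : Set} (P? : Dec P) (Q? : Dec Q) → (P → Q) → (Q → P) → ⟦ P? ⟧ ≡ ⟦ Q? ⟧
⟦⟧-cong P? (yes q) P⇒Q Q⇒P = ⟦⟧-true P? (Q⇒P q)
⟦⟧-cong P? (no ¬q) P⇒Q Q⇒P = ⟦⟧-false P? (¬q ∘ P⇒Q)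

-- In each of n consecutive blocks of length p only the last term survives.
∑-multiples : ∀ p n (f : ℕ → ℤ) → 1 ≤ℕ p → ∑ (n ℕ.* p) (λ d → ⟦ p ℕ∣.∣? d ⟧ * f d) ≡ ∑ n (λ d → f (d ℕ.* p))
∑-multiples p zero    f _   = refl
∑-multiples p@(suc p′) (suc n) f 1≤p = begin
  ∑ (p ℕ.+ n ℕ.* p) h                                             ≡⟨ cong (λ t → ∑ t h) (ℕₚ.+-comm p (n ℕ.* p)) ⟩
  ∑ (n ℕ.* p ℕ.+ p) h                                             ≡⟨ ∑-split (n ℕ.* p) p h ⟩
  ∑ (n ℕ.* p) h + (∑ p′ (λ i → h (n ℕ.* p ℕ.+ i)) + h (n ℕ.* p ℕ.+ p)) ≡⟨ cong₂ _+_ (∑-multiples p n f 1≤p) (cong₂ _+_ (∑-zero p′ non-multiple) multiple) ⟩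
  ∑ n (λ d → f (d ℕ.* p)) + (+ 0 + f (suc n ℕ.* p))               ≡⟨ cong (_+_ (∑ n (λ d → f (d ℕ.* p)))) (ℤₚ.+-identityˡ (f (suc n ℕ.* p))) ⟩
  ∑ (suc n) (λ d → f (d ℕ.* p))                                   ∎
  where
  open ≡-Reasoning
  h : ℕ → ℤ
  h d = ⟦ p ℕ∣.∣? d ⟧ * f d
  non-multiple : ∀ i → 1 ≤ℕ i → i ≤ℕ p′ → h (n ℕ.* p ℕ.+ i) ≡ + 0
  non-multiple i@(suc _) _ i≤p′ = trans (cong (_* f (n ℕ.* p ℕ.+ i)) (⟦⟧-false (p ℕ∣.∣? (n ℕ.* p ℕ.+ i))
    λ p∣ → ℕₚ.<⇒≱ (s≤s i≤p′) (ℕ∣.∣⇒≤ (ℕ∣.∣m+n∣m⇒∣n p∣ (ℕ∣.n∣m*n n))))) (ℤₚ.*-zeroˡ (f (n ℕ.* p ℕ.+ i)))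
  multiple : h (n ℕ.* p ℕ.+ p) ≡ f (suc n ℕ.* p)
  multiple = trans (cong h (ℕₚ.+-comm (n ℕ.* p) p)) (trans
    (cong (_* f (suc n ℕ.* p)) (⟦⟧-true (p ℕ∣.∣? (suc n ℕ.* p)) (ℕ∣.n∣m*n (suc n)))) (ℤₚ.*-identityˡ (f (suc n ℕ.* p))))

g : ℕ → ℤ
g n = ∑ n (λ d → χ d * ⟦ d ℕ∣.∣? n ⟧)

-- The counterpart of `r/`: d p ∣ n says d ∣ n/p, so for n ≥ 1 this is g(n/p), or 0 if p ∤ n.
g/ : ℕ → ℕ → ℤ
g/ p n = ∑ n (λ d → χ d * ⟦ d ℕ.* p ℕ∣.∣? n ⟧)

g-bound : ∀ n {N} → 1 ≤ℕ n → n ≤ℕ N → ∑ N (λ d → χ d * ⟦ d ℕ∣.∣? n ⟧) ≡ g n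
g-bound n@(suc _) 1≤n n≤N = ∑-extend (λ d → χ d * ⟦ d ℕ∣.∣? n ⟧) n≤N λ d n<d →
  trans (cong (χ d *_) (⟦⟧-false (d ℕ∣.∣? n) λ d∣n → ℕₚ.<⇒≱ n<d (ℕ∣.∣⇒≤ d∣n))) (ℤₚ.*-zeroʳ (χ d))

-- A divisor of p n that does not divide n is d p with d ∣ n and d p ∤ n. Since χ is multiplicative,
-- these add χ(p) (g(n) - g(n/p)) to g(n).
hecke-g : ∀ {p} → Prime p → ∀ n → 1 ≤ℕ n → g (p ℕ.* n) + χ p * g/ p n ≡ (+ 1 + χ p) * g n
hecke-g {p} pr n 1≤n = begin
  g (p ℕ.* n) + χ p * g/ p n                           ≡⟨ cong (_+ χ p * g/ p n) expansion ⟩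
  g n + χ p * (g n - g/ p n) + χ p * g/ p n            ≡⟨ collect (g n) (χ p) (g/ p n) ⟩
  (+ 1 + χ p) * g n                                    ∎
  where
  open ≡-Reasoning
  collect : ∀ a c b → a + c * (a - b) + c * b ≡ (+ 1 + c) * a
  collect = solve-∀
  1≤p : 1 ≤ℕ p
  1≤p = ℕ.>-nonZero⁻¹ p {{prime⇒nonZero pr}}
  new : ℕ → ℤ
  new d = χ d * (⟦ d ℕ∣.∣? n ℕ.* p ⟧ - ⟦ d ℕ∣.∣? n ⟧)
  new-divisors : ∀ d → χ d * ⟦ d ℕ∣.∣? n ℕ.* p ⟧ ≡ χ d * ⟦ d ℕ∣.∣? n ⟧ + ⟦ p ℕ∣.∣? d ⟧ * new d
  new-divisors d with p ℕ∣.∣? d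
  ... | yes _  = add-subtract (χ d) ⟦ d ℕ∣.∣? n ℕ.* p ⟧ ⟦ d ℕ∣.∣? n ⟧
    where
    add-subtract : ∀ c a b → c * a ≡ c * b + + 1 * (c * (a - b))
    add-subtract = solve-∀
  ... | no p∤d = trans (cong (χ d *_) (⟦⟧-cong (d ℕ∣.∣? n ℕ.* p) (d ℕ∣.∣? n)
      (λ d∣ → coprime-divisor coprime (subst (d ℕ∣.∣_) (ℕₚ.*-comm n p) d∣)) (λ d∣n → ℕ∣.∣-trans d∣n (ℕ∣.m∣m*n p))))
      (add-zero (χ d * ⟦ d ℕ∣.∣? n ⟧) (new d))
    where
    add-zero : ∀ a b → a ≡ a + + 0 * b
    add-zero = solve-∀
    coprime : Coprime d p
    coprime (k∣d , k∣p) with prime⇒irreducible pr k∣p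
    ... | inj₁ k≡1  = k≡1
    ... | inj₂ refl = ⊥-elim (p∤d k∣d)
  new-multiple : ∀ d → new (d ℕ.* p) ≡ χ p * (χ d * ⟦ d ℕ∣.∣? n ⟧ + - + 1 * (χ d * ⟦ d ℕ.* p ℕ∣.∣? n ⟧))
  new-multiple d = trans (cong₂ (λ c i → c * (i - ⟦ d ℕ.* p ℕ∣.∣? n ⟧)) (χ-* d p)
      (⟦⟧-cong (d ℕ.* p ℕ∣.∣? n ℕ.* p) (d ℕ∣.∣? n) (ℕ∣.*-cancelʳ-∣ p {{prime⇒nonZero pr}}) (ℕ∣.*-monoˡ-∣ p)))
    (distribute (χ d) (χ p) ⟦ d ℕ∣.∣? n ⟧ ⟦ d ℕ.* p ℕ∣.∣? n ⟧)
    where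
    distribute : ∀ c e a b → c * e * (a - b) ≡ e * (c * a + - + 1 * (c * b))
    distribute = solve-∀
  expansion : g (p ℕ.* n) ≡ g n + χ p * (g n - g/ p n)
  expansion = begin
    g (p ℕ.* n) ≡⟨ cong g (ℕₚ.*-comm p n) ⟩
    ∑ (n ℕ.* p) (λ d → χ d * ⟦ d ℕ∣.∣? n ℕ.* p ⟧)      ≡⟨ ∑-cong (n ℕ.* p) (λ d _ _ → new-divisors d) ⟩
    ∑ (n ℕ.* p) (λ d → χ d * ⟦ d ℕ∣.∣? n ⟧ + ⟦ p ℕ∣.∣? d ⟧ * new d) ≡⟨ ∑-+ (n ℕ.* p) (λ d → χ d * ⟦ d ℕ∣.∣? n ⟧) (λ d → ⟦ p ℕ∣.∣? d ⟧ * new d) ⟩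
    ∑ (n ℕ.* p) (λ d → χ d * ⟦ d ℕ∣.∣? n ⟧) + ∑ (n ℕ.* p) (λ d → ⟦ p ℕ∣.∣? d ⟧ * new d)
      ≡⟨ cong₂ _+_ (g-bound n 1≤n (ℕₚ.m≤m*n n p {{prime⇒nonZero pr}})) (∑-multiples p n new 1≤p) ⟩
    g n + ∑ n (λ d → new (d ℕ.* p))                     ≡⟨ cong (_+_ (g n)) (trans (∑-cong n (λ d _ _ → new-multiple d)) (∑-* n (χ p) _)) ⟩
    g n + χ p * ∑ n (λ d → χ d * ⟦ d ℕ∣.∣? n ⟧ + - + 1 * (χ d * ⟦ d ℕ.* p ℕ∣.∣? n ⟧))
      ≡⟨ cong (λ t → g n + χ p * t) (trans (∑-+ n (λ d → χ d * ⟦ d ℕ∣.∣? n ⟧) (λ d → - + 1 * (χ d * ⟦ d ℕ.* p ℕ∣.∣? n ⟧))) (cong (_+_ (g n)) (trans (∑-* n (- + 1) (λ d → χ d * ⟦ d ℕ.* p ℕ∣.∣? n ⟧)) (ℤₚ.-1*i≡-i (g/ p n))))) ⟩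
    g n + χ p * (g n - g/ p n)                          ∎

g/-multiple : ∀ p n .{{_ : NonZero p}} → 1 ≤ℕ n → g/ p (n ℕ.* p) ≡ g n
g/-multiple p n 1≤n = trans
  (∑-cong (n ℕ.* p) λ d _ _ → cong (χ d *_) (⟦⟧-cong (d ℕ.* p ℕ∣.∣? n ℕ.* p) (d ℕ∣.∣? n) (ℕ∣.*-cancelʳ-∣ p) (ℕ∣.*-monoˡ-∣ p)))
  (g-bound n 1≤n (ℕₚ.m≤m*n n p))

g/-non-multiple : ∀ p n → ¬ p ℕ∣.∣ n → g/ p n ≡ + 0
g/-non-multiple p n p∤n = ∑-zero n λ d _ _ →
  trans (cong (χ d *_) (⟦⟧-false (d ℕ.* p ℕ∣.∣? n) λ dp∣n → p∤n (ℕ∣.∣-trans (ℕ∣.n∣m*n d) dp∣n))) (ℤₚ.*-zeroʳ (χ d))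

-- Summation over the ellipse

#-empty : {P : A → Set} (e : Enumeration P) → (∀ a → ¬ P a) → # e ≡ 0
#-empty e none with Enumeration.elements e in eq
... | []    = refl
... | a ∷ _ = ⊥-elim (none a (sound e (subst (a ∈_) (sym eq) (here refl))))

r/-multiple : ∀ p .{{_ : NonZero p}} n → r/ p (n ℕ.* p) ≡ r n
r/-multiple p n = #-bijection (reps/ p (n ℕ.* p)) (reps n) id
  (λ {α} eq → ℤₚ.*-cancelˡ-≡ (+ p) (norm α) (+ n) (trans eq np≡)) id
  (λ {α} eq → α , trans (cong (+ p *_) eq) (sym np≡) , refl)
  where
  np≡ : + (n ℕ.* p) ≡ + p * + n
  np≡ = trans (ℤₚ.pos-* n p) (ℤₚ.*-comm (+ n) (+ p))

r/-non-multiple : ∀ p .{{_ : NonZero p}} n → ¬ p ℕ∣.∣ n → r/ p n ≡ 0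
r/-non-multiple p n p∤n = #-empty (reps/ p n) λ α eq → p∤n (∣⇒∣ᵤ (divides (norm α) (trans (sym eq) (ℤₚ.*-comm (+ p) (norm α)))))

prime-divisor : ∀ n → 2 ≤ℕ n → ∃₂ λ p q → Prime p × n ≡ p ℕ.* q
prime-divisor (suc zero) (s≤s ())
prime-divisor n@(suc (suc _)) _ = from-factors factors isFactorisation factorsPrime
  where
  open PrimeFactorisation (factorise n)
  from-factors : ∀ fs → n ≡ product fs → All Prime fs → ∃₂ λ p q → Prime p × n ≡ p ℕ.* q
  from-factors (p ∷ ps) n≡ (pr ∷ _) = p , product ps , pr , n≡

-- Strong induction: for n = p q both Hecke relations express the value at n through those at q and
-- q/p. The factor 2 is r(1), the number of units ±1.
r≡2g : ∀ n → 1 ≤ℕ n → + r n ≡ + 2 * g n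
r≡2g = <-rec _ step
  where
  step : ∀ n → (∀ {m} → m ℕ.< n → 1 ≤ℕ m → + r m ≡ + 2 * g m) → 1 ≤ℕ n → + r n ≡ + 2 * g n
  step 1 _ _ = refl
  step n@(suc (suc _)) rec 1≤n = by-prime (prime-divisor n (s≤s (s≤s z≤n)))
    where
    by-prime : ∃₂ (λ p q → Prime p × n ≡ p ℕ.* q) → + r n ≡ + 2 * g n
    by-prime (p , zero , pr , n≡) = ⊥-elim (ℕₚ.1+n≢0 (trans n≡ (ℕₚ.*-zeroʳ p)))
    by-prime (p , q@(suc _) , pr , n≡) = subst (λ t → + r t ≡ + 2 * g t) (sym n≡)
      (solve-for (+ r (p ℕ.* q)) (g (p ℕ.* q)) (+ r q) (g q) (+ r/ p q) (g/ p q) (χ p)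
        (hecke-r pr q) (hecke-g pr q (s≤s z≤n)) (rec q<n (s≤s z≤n)) (quotients (p ℕ∣.∣? q)))
      where
      instance
        p-nonZero : NonZero p
        p-nonZero = prime⇒nonZero pr
      q<n : q ℕ.< n
      q<n = subst (q ℕ.<_) (trans (ℕₚ.*-comm q p) (sym n≡)) (ℕₚ.m<m*n q p (ℕ.nonTrivial⇒n>1 p {{prime⇒nonTrivial pr}}))
      quotients : Dec (p ℕ∣.∣ q) → + r/ p q ≡ + 2 * g/ p q
      quotients (yes (ℕ∣.divides t@(suc _) q≡)) = trans (cong +_ (trans (cong (r/ p) q≡) (r/-multiple p t)))
        (trans (rec (ℕₚ.≤-<-trans (subst (t ≤ℕ_) (sym q≡) (ℕₚ.m≤m*n t p)) q<n) (s≤s z≤n))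
          (cong (+ 2 *_) (sym (trans (cong (g/ p) q≡) (g/-multiple p t (s≤s z≤n))))))
      quotients (no p∤q) = trans (cong +_ (r/-non-multiple p q p∤q)) (sym (cong (+ 2 *_) (g/-non-multiple p q p∤q)))
      solve-for : ∀ r₁ g₁ r₂ g₂ r₃ g₃ c → r₁ + c * r₃ ≡ (+ 1 + c) * r₂ → g₁ + c * g₃ ≡ (+ 1 + c) * g₂ →
        r₂ ≡ + 2 * g₂ → r₃ ≡ + 2 * g₃ → r₁ ≡ + 2 * g₁
      solve-for r₁ g₁ r₂ g₂ r₃ g₃ c hr hg refl refl = begin
        r₁                                              ≡⟨ add-subtract r₁ (c * (+ 2 * g₃)) ⟩
        r₁ + c * (+ 2 * g₃) - c * (+ 2 * g₃)            ≡⟨ cong (_- c * (+ 2 * g₃)) hr ⟩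
        (+ 1 + c) * (+ 2 * g₂) - c * (+ 2 * g₃)         ≡⟨ factor g₂ g₃ c ⟩
        + 2 * ((+ 1 + c) * g₂ - c * g₃)                 ≡⟨ cong (λ t → + 2 * (t - c * g₃)) hg ⟨
        + 2 * (g₁ + c * g₃ - c * g₃)                    ≡⟨ cong (+ 2 *_) (add-subtract g₁ (c * g₃)) ⟨
        + 2 * g₁                                        ∎
        where
        open ≡-Reasoning
        add-subtract : ∀ a b → a ≡ a + b - b
        add-subtract = solve-∀
        factor : ∀ a b c → (+ 1 + c) * (+ 2 * a) - c * (+ 2 * b) ≡ + 2 * ((+ 1 + c) * a - c * b)
        factor = solve-∀

F-suc : ∀ n → F (suc n) ≡ F n ℕ.+ r (suc n)
F-suc n = trans (#-split (ellipse (suc n)) (inEllipse? n)) (cong₂ ℕ._+_ inside boundary)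
  where
  inside : # (restrict (ellipse (suc n)) (inEllipse? n)) ≡ F n
  inside = #-bijection (restrict (ellipse (suc n)) (inEllipse? n)) (ellipse n) id proj₂ id
    λ {α} α∈ → α , (ℤₚ.≤-trans α∈ (+≤+ (ℕₚ.n≤1+n n)) , α∈) , refl
  boundary : # (restrict (ellipse (suc n)) (¬? ∘ inEllipse? n)) ≡ r (suc n)
  boundary = #-bijection (restrict (ellipse (suc n)) (¬? ∘ inEllipse? n)) (reps (suc n)) id (λ {α} → to {α}) id
    λ {α} eq → α , from α eq , refl
    where
    to : ∀ {α} → InEllipse (suc n) α × ¬ InEllipse n α → norm α ≡ + suc n
    to {x , y} (α∈ , α∉) = trans (norm≡^ x y) (ℤₚ.≤-antisym α∈ (ℤₚ.i<j⇒suc[i]≤j (ℤₚ.≰⇒> α∉)))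
    from : ∀ α → norm α ≡ + suc n → InEllipse (suc n) α × ¬ InEllipse n α
    from (x , y) eq = ℤₚ.≤-reflexive x²+2y²≡ , λ α∈ → ℕₚ.1+n≰n (ℤₚ.drop‿+≤+ (subst (ℤ._≤ + n) x²+2y²≡ α∈))
      where
      x²+2y²≡ : x ^ 2 + + 2 * y ^ 2 ≡ + suc n
      x²+2y²≡ = trans (sym (norm≡^ x y)) eq

F≡∑g : ∀ n → + F n ≡ + 1 + + 2 * ∑ n g
F≡∑g zero    = refl
F≡∑g (suc n) = begin
  + F (suc n)                                   ≡⟨ cong +_ (F-suc n) ⟩
  + F n + + r (suc n)                           ≡⟨ cong₂ _+_ (F≡∑g n) (r≡2g (suc n) (s≤s z≤n)) ⟩
  + 1 + + 2 * ∑ n g + + 2 * g (suc n)           ≡⟨ factor (∑ n g) (g (suc n)) ⟩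
  + 1 + + 2 * ∑ (suc n) g                       ∎
  where
  open ≡-Reasoning
  factor : ∀ a b → + 1 + + 2 * a + + 2 * b ≡ + 1 + + 2 * (a + b)
  factor = solve-∀

∑-unique : ∀ n {P : ℕ → Set} (P? : Decidable P) m → 1 ≤ℕ m → m ≤ℕ n → P m → (∀ i → P i → i ≡ m) →
  ∑ n (λ i → ⟦ P? i ⟧) ≡ + 1
∑-unique n {P} P? (suc m) _ m≤n Pm unique = trans
  (∑-extend (λ i → ⟦ P? i ⟧) m≤n λ i m<i → ⟦⟧-false (P? i) λ Pi → ℕₚ.<-irrefl (sym (unique i Pi)) m<i)
  (trans (cong₂ _+_ (∑-zero m λ i _ i≤m → ⟦⟧-false (P? i) λ Pi → ℕₚ.<-irrefl (unique i Pi) (s≤s i≤m)) (⟦⟧-true (P? (suc m)) Pm))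
    (ℤₚ.+-identityˡ (+ 1)))

-- The junk value at divisor 0 never occurs, as the sums start at 1.
_÷_ : ℕ → ℕ → ℕ
n ÷ zero  = 0
n ÷ suc e = n ℕ%./ suc e

-- Turns divisibility into a sum over cofactors e, in preparation for interchanging sums.
∣≡∑ : ∀ n d k → 1 ≤ℕ d → 1 ≤ℕ k → k ≤ℕ n → ⟦ d ℕ∣.∣? k ⟧ ≡ ∑ n (λ e → ⟦ e ℕ.* d ℕₚ.≟ k ⟧)
∣≡∑ n d@(suc _) k 1≤d 1≤k k≤n with d ℕ∣.∣? k
... | no d∤k = sym (∑-zero n λ e _ _ → ⟦⟧-false (e ℕ.* d ℕₚ.≟ k) λ ed≡k → d∤k (ℕ∣.divides e (sym ed≡k)))
... | yes (ℕ∣.divides zero refl) = ⊥-elim (ℕₚ.n≮0 1≤k)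
... | yes (ℕ∣.divides q@(suc _) k≡) = sym (∑-unique n (λ e → e ℕ.* d ℕₚ.≟ k) q (s≤s z≤n)
        (ℕₚ.≤-trans (subst (q ≤ℕ_) (sym k≡) (ℕₚ.m≤m*n q d)) k≤n) (sym k≡)
        λ e ed≡k → ℕₚ.*-cancelʳ-≡ e q d (trans ed≡k k≡))

∑≡≤ : ∀ n m → 1 ≤ℕ m → ∑ n (λ k → ⟦ m ℕₚ.≟ k ⟧) ≡ ⟦ m ℕₚ.≤? n ⟧
∑≡≤ n m 1≤m with m ℕₚ.≤? n
... | yes m≤n = ∑-unique n (m ℕₚ.≟_) m 1≤m m≤n refl λ _ → sym
... | no  m≰n = ∑-zero n λ k _ k≤n → ⟦⟧-false (m ℕₚ.≟ k) λ { refl → m≰n k≤n }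

∑-cutoff : ∀ {m n} (f : ℕ → ℤ) {P : ℕ → Set} (P? : Decidable P) → m ≤ℕ n →
  (∀ i → i ≤ℕ m → P i) → (∀ i → P i → i ≤ℕ m) → ∑ n (λ i → f i * ⟦ P? i ⟧) ≡ ∑ m f
∑-cutoff {m} f P? m≤n ≤⇒P P⇒≤ = trans
  (∑-extend (λ i → f i * ⟦ P? i ⟧) m≤n λ i m<i → trans (cong (f i *_) (⟦⟧-false (P? i) λ Pi → ℕₚ.<⇒≱ m<i (P⇒≤ i Pi))) (ℤₚ.*-zeroʳ (f i)))
  (∑-cong m λ i _ i≤m → trans (cong (f i *_) (⟦⟧-true (P? i) (≤⇒P i i≤m))) (ℤₚ.*-identityʳ (f i)))

-- Both sides add χ d over the pairs with e d ≤ n. All indices are first extended to the common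
-- range 1, ..., n, so that the sums can be swapped freely.
∑g≡∑∑χ : ∀ n → ∑ n g ≡ ∑ n (λ e → ∑ (n ÷ e) χ)
∑g≡∑∑χ n = begin
  ∑ n g
    ≡⟨ ∑-cong n (λ k 1≤k k≤n → trans (sym (g-bound k 1≤k k≤n)) (∑-cong n λ d 1≤d _ → trans
         (cong (χ d *_) (∣≡∑ n d k 1≤d 1≤k k≤n)) (sym (∑-* n (χ d) λ e → ⟦ e ℕ.* d ℕₚ.≟ k ⟧)))) ⟩
  ∑ n (λ k → ∑ n λ d → ∑ n λ e → χ d * ⟦ e ℕ.* d ℕₚ.≟ k ⟧)
    ≡⟨ ∑-cong n (λ k _ _ → ∑-swap n n λ d e → χ d * ⟦ e ℕ.* d ℕₚ.≟ k ⟧) ⟩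
  ∑ n (λ k → ∑ n λ e → ∑ n λ d → χ d * ⟦ e ℕ.* d ℕₚ.≟ k ⟧)
    ≡⟨ ∑-swap n n (λ k e → ∑ n λ d → χ d * ⟦ e ℕ.* d ℕₚ.≟ k ⟧) ⟩
  ∑ n (λ e → ∑ n λ k → ∑ n λ d → χ d * ⟦ e ℕ.* d ℕₚ.≟ k ⟧)
    ≡⟨ ∑-cong n (λ e 1≤e _ → trans (∑-swap n n λ k d → χ d * ⟦ e ℕ.* d ℕₚ.≟ k ⟧) (∑-cong n λ d 1≤d _ → trans
         (∑-* n (χ d) λ k → ⟦ e ℕ.* d ℕₚ.≟ k ⟧) (cong (χ d *_) (∑≡≤ n (e ℕ.* d) (ℕₚ.*-mono-≤ 1≤e 1≤d))))) ⟩
  ∑ n (λ e → ∑ n λ d → χ d * ⟦ e ℕ.* d ℕₚ.≤? n ⟧)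
    ≡⟨ ∑-cong n (λ e 1≤e _ → truncate e 1≤e) ⟩
  ∑ n (λ e → ∑ (n ÷ e) χ) ∎
  where
  open ≡-Reasoning
  truncate : ∀ e → 1 ≤ℕ e → ∑ n (λ d → χ d * ⟦ e ℕ.* d ℕₚ.≤? n ⟧) ≡ ∑ (n ÷ e) χ
  truncate e@(suc _) _ = ∑-cutoff χ (λ d → e ℕ.* d ℕₚ.≤? n) (ℕ%.m/n≤m n e)
    (λ d d≤ → ℕₚ.≤-trans (ℕₚ.*-monoʳ-≤ e d≤) (subst (_≤ℕ n) (ℕₚ.*-comm (n ℕ%./ e) e) (ℕ%.m/n*n≤m n e)))
    (λ d ed≤n → subst (_≤ℕ n ℕ%./ e) (trans (cong (ℕ%._/ e) (ℕₚ.*-comm e d)) (ℕ%.m*n/n≡m d e)) (ℕ%./-monoˡ-≤ e ed≤n))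

-- Floors of rationals and the counts 𝒩

z<1+w⇒z≤w : ∀ {z w} → z ℤ.< ℤ.suc w → z ℤ.≤ w
z<1+w⇒z≤w {z} {w} z<1+w = subst (z ℤ.≤_) (ℤₚ.pred-suc w) (ℤₚ.i<j⇒i≤pred[j] z<1+w)

/ℕ-unique : ∀ i d .{{_ : NonZero d}} z → z * + d ℤ.≤ i → i ℤ.< ℤ.suc z * + d → i ℤ%./ℕ d ≡ z
/ℕ-unique i d@(suc _) z lower upper = ℤₚ.≤-antisym
  (z<1+w⇒z≤w (ℤₚ.*-cancelʳ-<-nonNeg {i ℤ%./ℕ d} {ℤ.suc z} (+ d) (ℤₚ.≤-<-trans (ℤ%.[n/ℕd]*d≤n i d) upper)))
  (z<1+w⇒z≤w (ℤₚ.*-cancelʳ-<-nonNeg {z} {ℤ.suc (i ℤ%./ℕ d)} (+ d) (ℤₚ.≤-<-trans lower (ℤ%.n<s[n/ℕd]*d i d))))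

-- `floor` sees only the reduced form of a rational. Cross-multiplying the bounds z d ≤ i < (z + 1)
-- d transfers its value to any fraction i/d equal to it.
floor-≃ : ∀ q i d .{{_ : NonZero d}} → ℚ.toℚᵘ q ℚᵘ.≃ i ℚᵘ./ d → floor q ≡ i ℤ%./ℕ d
floor-≃ (ℚ.mkℚ u v-1 _) i d@(suc _) (ℚᵘ.*≡* ud≡iv) = trans (ℤ%.div-pos-is-/ℕ u v) (sym (/ℕ-unique i d z lower upper))
  where
  v : ℕ
  v = suc v-1
  z : ℤ
  z = u ℤ%./ℕ v
  swap : ∀ z v d → z * v * d ≡ z * d * v
  swap = solve-∀
  lower : z * + d ℤ.≤ i
  lower = ℤₚ.*-cancelʳ-≤-pos (z * + d) i (+ v) (begin
    z * + d * + v  ≡⟨ swap z (+ d) (+ v) ⟩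
    z * + v * + d  ≤⟨ ℤₚ.*-monoʳ-≤-nonNeg (+ d) (ℤ%.[n/ℕd]*d≤n u v) ⟩
    u * + d        ≡⟨ ud≡iv ⟩
    i * + v        ∎)
    where open ℤₚ.≤-Reasoning
  upper : i ℤ.< ℤ.suc z * + d
  upper = ℤₚ.*-cancelʳ-<-nonNeg {i} {ℤ.suc z * + d} (+ v) (begin-strict
    i * + v                ≡⟨ ud≡iv ⟨
    u * + d                <⟨ ℤₚ.*-monoʳ-<-pos (+ d) (ℤ%.n<s[n/ℕd]*d u v) ⟩
    ℤ.suc z * + v * + d    ≡⟨ swap (ℤ.suc z) (+ v) (+ d) ⟩
    ℤ.suc z * + d * + v    ∎)
    where open ℤₚ.≤-Reasoning

toℚᵘ-/ : ∀ i d .{{_ : NonZero d}} → ℚ.toℚᵘ (i / d) ℚᵘ.≃ i ℚᵘ./ d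
toℚᵘ-/ i (suc d-1) = ℚₚ.toℚᵘ-fromℚᵘ (ℚᵘ.mkℚᵘ i d-1)

floor-/ : ∀ i d .{{_ : NonZero d}} → floor (i / d) ≡ i ℤ%./ℕ d
floor-/ i d = floor-≃ (i / d) i d (toℚᵘ-/ i d)

⌈_/4⌉ : ℕ → ℕ
⌈ n /4⌉ = (n ℕ.+ 3) ℕ%./ 4

floor-neg/4 : ∀ n → (- + n) ℤ%./ℕ 4 ≡ - + ⌈ n /4⌉
floor-neg/4 n = /ℕ-unique (- + n) 4 (- + c) lower upper
  where
  c : ℕ
  c = ⌈ n /4⌉
  open ℤₚ.≤-Reasoning
  lower : - + c * + 4 ℤ.≤ - + n
  lower = begin
    - + c * + 4       ≡⟨ trans (sym (ℤₚ.neg-distribˡ-* (+ c) (+ 4))) (cong -_ (sym (ℤₚ.pos-* c 4))) ⟩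
    - + (c ℕ.* 4)     ≤⟨ ℤₚ.neg-mono-≤ (+≤+ n≤4c) ⟩
    - + n             ∎
    where
    n≤4c : n ≤ℕ c ℕ.* 4
    n≤4c = ℕₚ.+-cancelʳ-≤ 3 n (c ℕ.* 4) (rounded (ℕ%.m≡m%n+[m/n]*n (n ℕ.+ 3) 4) (ℕ.s≤s⁻¹ (ℕ%.m%n<n (n ℕ.+ 3) 4)))
      where
      rounded : ∀ {a b s} → a ≡ s ℕ.+ b → s ≤ℕ 3 → a ≤ℕ b ℕ.+ 3
      rounded {b = b} refl s≤3 = ℕₚ.≤-trans (ℕₚ.+-monoˡ-≤ b s≤3) (ℕₚ.≤-reflexive (ℕₚ.+-comm 3 b))
  upper : - + n ℤ.< ℤ.suc (- + c) * + 4
  upper = begin-strict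
    - + n                       ≡⟨ shift3 (+ n) ⟩
    + 3 - + (n ℕ.+ 3)           ≤⟨ ℤₚ.+-monoʳ-≤ (+ 3) (ℤₚ.neg-mono-≤ (+≤+ (ℕ%.m/n*n≤m (n ℕ.+ 3) 4))) ⟩
    + 3 - + (c ℕ.* 4)           <⟨ ℤₚ.+-monoˡ-< (- + (c ℕ.* 4)) (ℤ.+<+ (ℕₚ.n<1+n 3)) ⟩
    + 4 - + (c ℕ.* 4)           ≡⟨ cong (λ t → + 4 - t) (ℤₚ.pos-* c 4) ⟩
    + 4 - + c * + 4             ≡⟨ factor (+ c) ⟩
    ℤ.suc (- + c) * + 4         ∎
    where
    shift3 : ∀ n → - n ≡ + 3 - (n + + 3)
    shift3 = solve-∀
    factor : ∀ c → + 4 - c * + 4 ≡ (+ 1 + - c) * + 4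
    factor = solve-∀

ceiling-neg : ∀ q → ceiling q ≡ - floor (ℚ.- q)
ceiling-neg (ℚ.mkℚ _ _ _) = refl

ceiling-/4 : ∀ n → ceiling (+ n / 4) ≡ + ⌈ n /4⌉
ceiling-/4 n = begin
  ceiling (+ n / 4)            ≡⟨ ceiling-neg (+ n / 4) ⟩
  - floor (ℚ.- (+ n / 4))      ≡⟨ cong -_ (floor-≃ (ℚ.- (+ n / 4)) (- + n) 4 (ℚᵘₚ.≃-trans (ℚₚ.toℚᵘ-homo‿- (+ n / 4)) (ℚᵘₚ.-‿cong (toℚᵘ-/ (+ n) 4)))) ⟩
  - ((- + n) ℤ%./ℕ 4)          ≡⟨ cong -_ (floor-neg/4 n) ⟩
  - - + ⌈ n /4⌉                ≡⟨ ℤₚ.neg-involutive (+ ⌈ n /4⌉) ⟩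
  + ⌈ n /4⌉                    ∎
  where open ≡-Reasoning

toℚᵘ-minus : ∀ p q → ℚ.toℚᵘ (p ℚ.- q) ℚᵘ.≃ ℚ.toℚᵘ p ℚᵘ.- ℚ.toℚᵘ q
toℚᵘ-minus p q = ℚᵘₚ.≃-trans (ℚₚ.toℚᵘ-homo-+ p (ℚ.- q)) (ℚᵘₚ.+-congʳ (ℚ.toℚᵘ p) (ℚₚ.toℚᵘ-homo‿- q))

-- ⌈n/4⌉ = -⌊-n/4⌋, so subtracting the fractional part of -n/4 leaves exactly n/4.
⌈n/4⌉-ν : ∀ n → ℚ.toℚᵘ (+ ⌈ n /4⌉ / 1 ℚ.- frac ((- + n) / 4)) ℚᵘ.≃ + n ℚᵘ./ 4
⌈n/4⌉-ν n = begin
  ℚ.toℚᵘ (+ c / 1 ℚ.- frac x)                            ≈⟨ toℚᵘ-minus (+ c / 1) (frac x) ⟩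
  ℚ.toℚᵘ (+ c / 1) ℚᵘ.- ℚ.toℚᵘ (frac x)                  ≈⟨ ℚᵘₚ.+-cong (toℚᵘ-/ (+ c) 1) (ℚᵘₚ.-‿cong (ℚᵘₚ.≃-trans (toℚᵘ-minus x (floor x / 1))
                                                             (ℚᵘₚ.+-cong (toℚᵘ-/ (- + n) 4) (ℚᵘₚ.-‿cong (ℚᵘₚ.≃-trans (ℚᵘₚ.≃-reflexive (cong (λ z → ℚ.toℚᵘ (z / 1)) floor-x)) (toℚᵘ-/ (- + c) 1)))))) ⟩
  + c ℚᵘ./ 1 ℚᵘ.- ((- + n) ℚᵘ./ 4 ℚᵘ.- (- + c) ℚᵘ./ 1)   ≈⟨ ℚᵘ.*≡* (identity (+ c) (+ n)) ⟩
  + n ℚᵘ./ 4                                             ∎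
  where
  open ℚᵘₚ.≃-Reasoning
  c : ℕ
  c = ⌈ n /4⌉
  x : ℚ.ℚ
  x = (- + n) / 4
  floor-x : floor x ≡ - + c
  floor-x = trans (floor-/ (- + n) 4) (floor-neg/4 n)
  identity : ∀ c n → (c * + 4 + - (- n * + 1 + - - c * + 4) * + 1) * + 4 ≡ n * + 4
  identity = solve-∀

-- (n/4)/k + a/4 is (n + a k)/(4k); taking the floor after dividing by k, and again after dividing
-- by 4, does not change the result.
quotient≡ : ∀ n a (j : Fin ⌈ n /4⌉) →
  quotient ⌈ n /4⌉ (+ a / 4) (frac ((- + n) / 4)) j ≡ + ((n ÷ suc (toℕ j) ℕ.+ a) ℕ%./ 4)
quotient≡ n a j = trans (floor-≃ (y ℚ.* z ℚ.+ + a / 4) (+ (n ℕ.+ a ℕ.* k)) (4 ℕ.* k) value) (cong +_ divide)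
  where
  k : ℕ
  k = suc (toℕ j)
  y z : ℚ.ℚ
  y = + ⌈ n /4⌉ / 1 ℚ.- frac ((- + n) / 4)
  z = + 1 / k
  value : ℚ.toℚᵘ (y ℚ.* z ℚ.+ + a / 4) ℚᵘ.≃ + (n ℕ.+ a ℕ.* k) ℚᵘ./ (4 ℕ.* k)
  value = begin
    ℚ.toℚᵘ (y ℚ.* z ℚ.+ + a / 4)                     ≈⟨ ℚₚ.toℚᵘ-homo-+ (y ℚ.* z) (+ a / 4) ⟩
    ℚ.toℚᵘ (y ℚ.* z) ℚᵘ.+ ℚ.toℚᵘ (+ a / 4)           ≈⟨ ℚᵘₚ.+-cong (ℚᵘₚ.≃-trans (ℚₚ.toℚᵘ-homo-* y z) (ℚᵘₚ.*-cong (⌈n/4⌉-ν n) (toℚᵘ-/ (+ 1) k))) (toℚᵘ-/ (+ a) 4) ⟩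
    (+ n ℚᵘ./ 4) ℚᵘ.* (+ 1 ℚᵘ./ k) ℚᵘ.+ (+ a ℚᵘ./ 4) ≈⟨ ℚᵘ.*≡* cross ⟩
    + (n ℕ.+ a ℕ.* k) ℚᵘ./ (4 ℕ.* k)                 ∎
    where
    open ℚᵘₚ.≃-Reasoning
    cross : (+ n * + 1 * + 4 + + a * + (4 ℕ.* k)) * + (4 ℕ.* k) ≡ + (n ℕ.+ a ℕ.* k) * + (4 ℕ.* k ℕ.* 4)
    cross = trans (cong (λ t → (+ n * + 1 * + 4 + + a * t) * t) (ℤₚ.pos-* 4 k))
      (trans (identity (+ n) (+ a) (+ k))
        (sym (cong₂ (λ s t → (+ n + s) * t) (ℤₚ.pos-* a k) (trans (ℤₚ.pos-* (4 ℕ.* k) 4) (cong (_* + 4) (ℤₚ.pos-* 4 k))))))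
      where
      identity : ∀ n a k → (n * + 1 * + 4 + a * (+ 4 * k)) * (+ 4 * k) ≡ (n + a * k) * (+ 4 * k * + 4)
      identity = solve-∀
  divide : (n ℕ.+ a ℕ.* k) ℕ%./ (4 ℕ.* k) ≡ (n ℕ%./ k ℕ.+ a) ℕ%./ 4
  divide = R.begin
    (n ℕ.+ a ℕ.* k) ℕ%./ (4 ℕ.* k)           R.≡⟨ ℕ%./-congʳ {m = n ℕ.+ a ℕ.* k} (ℕₚ.*-comm 4 k) ⟩
    (n ℕ.+ a ℕ.* k) ℕ%./ (k ℕ.* 4)           R.≡⟨ ℕ%.m/n/o≡m/[n*o] (n ℕ.+ a ℕ.* k) k 4 ⟨
    (n ℕ.+ a ℕ.* k) ℕ%./ k ℕ%./ 4            R.≡⟨ cong (ℕ%._/ 4) (trans (ℕ%.+-distrib-/-∣ʳ n (ℕ∣.n∣m*n a)) (cong (n ℕ%./ k ℕ.+_) (ℕ%.m*n/n≡m a k))) ⟩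
    (n ℕ%./ k ℕ.+ a) ℕ%./ 4                  R.∎
    where module R = ≡-Reasoning

-- Parity is phrased as the test made by `counted?` for r = 1 and m = 2.
odd⟦_⟧ : ℕ → ℤ
odd⟦ m ⟧ = ⟦ + 2 ∣? (+ m - + 1) ⟧

-- `∑` unfolds at its last term, `tabulate` at its first; this reconciles the two.
∑-front : ∀ n f → ∑ (suc n) f ≡ f 1 + ∑ n (f ∘ suc)
∑-front n f = trans (∑-split 1 n f) (cong (_+ ∑ n (f ∘ suc)) (ℤₚ.+-identityˡ (f 1)))

length-filter-tabulate : {P : A → Set} (P? : Decidable P) → ∀ n (a : Fin n → A) h →
  (∀ j → ⟦ P? (a j) ⟧ ≡ h (suc (toℕ j))) → + length (filter P? (tabulate a)) ≡ ∑ n h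
length-filter-tabulate P? zero    a h eq = refl
length-filter-tabulate P? (suc n) a h eq with P? (a Fin.zero) | eq Fin.zero | length-filter-tabulate P? n (a ∘ Fin.suc) (h ∘ suc) (eq ∘ Fin.suc)
... | yes _ | h1 | rec = trans (cong₂ _+_ h1 rec) (sym (∑-front n h))
... | no  _ | h1 | rec = trans (sym (ℤₚ.+-identityˡ _)) (trans (cong₂ _+_ h1 rec) (sym (∑-front n h)))

𝒩≡∑ : ∀ n a → + 𝒩 ⌈ n /4⌉ (+ a / 4) (frac ((- + n) / 4)) (+ 1) 2 ≡ ∑ ⌈ n /4⌉ (λ k → odd⟦ (n ÷ k ℕ.+ a) ℕ%./ 4 ⟧)
𝒩≡∑ n a = length-filter-tabulate (counted? ⌈ n /4⌉ (+ a / 4) (frac ((- + n) / 4)) (+ 1) 2) ⌈ n /4⌉ id (λ k → odd⟦ (n ÷ k ℕ.+ a) ℕ%./ 4 ⟧)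
  λ j → cong (λ t → ⟦ + 2 ∣? (t - + 1) ⟧) (quotient≡ n a j)

odd-2+ : ∀ m → odd⟦ 2 ℕ.+ m ⟧ ≡ odd⟦ m ⟧
odd-2+ m = ⟦⟧-cong (+ 2 ∣? (+ (2 ℕ.+ m) - + 1)) (+ 2 ∣? (+ m - + 1))
  (λ d → ∣m+n∣m⇒∣n (subst (+ 2 ∣_) (regroup (+ m)) d) ∣-refl) (λ d → subst (+ 2 ∣_) (sym (regroup (+ m))) (∣m∣n⇒∣m+n ∣-refl d))
  where
  regroup : ∀ m → + 2 + m - + 1 ≡ + 2 + (m - + 1)
  regroup = solve-∀

-- As t runs modulo 8, the first quotient is odd on 1, ..., 4 and the second on 3, ..., 6, so their
-- count rises at 1 and 3 and falls at 5 and 7, just as χ prescribes. A full period has sum 0 and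
-- raises both quotients by 2.
∑χ≡odd : ∀ t → ∑ t χ ≡ odd⟦ (t ℕ.+ 3) ℕ%./ 4 ⟧ + odd⟦ (t ℕ.+ 1) ℕ%./ 4 ⟧
∑χ≡odd 0 = refl
∑χ≡odd 1 = refl
∑χ≡odd 2 = refl
∑χ≡odd 3 = refl
∑χ≡odd 4 = refl
∑χ≡odd 5 = refl
∑χ≡odd 6 = refl
∑χ≡odd 7 = refl
∑χ≡odd (suc (suc (suc (suc (suc (suc (suc (suc t)))))))) = begin
  ∑ (8 ℕ.+ t) χ                                                        ≡⟨ ∑-split 8 t χ ⟩
  + 0 + ∑ t χ                                                          ≡⟨ ℤₚ.+-identityˡ (∑ t χ) ⟩
  ∑ t χ                                                                ≡⟨ ∑χ≡odd t ⟩
  odd⟦ (t ℕ.+ 3) ℕ%./ 4 ⟧ + odd⟦ (t ℕ.+ 1) ℕ%./ 4 ⟧                    ≡⟨ cong₂ _+_ (period 3) (period 1) ⟩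
  odd⟦ (8 ℕ.+ t ℕ.+ 3) ℕ%./ 4 ⟧ + odd⟦ (8 ℕ.+ t ℕ.+ 1) ℕ%./ 4 ⟧        ∎
  where
  open ≡-Reasoning
  period : ∀ a → odd⟦ (t ℕ.+ a) ℕ%./ 4 ⟧ ≡ odd⟦ (8 ℕ.+ t ℕ.+ a) ℕ%./ 4 ⟧
  period a = trans (sym (odd-2+ ((t ℕ.+ a) ℕ%./ 4))) (cong odd⟦_⟧ (sym (ℕ%.+-distrib-/-∣ˡ (t ℕ.+ a) {d = 4} (ℕ∣.divides 2 refl))))

-- Quotients beyond ⌈n/4⌉

-- From 4⌈n/4⌉ ≤ n + 3 follows 12⌈n/4⌉ ≤ 3n + 9, which is at most 4n once n ≥ 9. Smaller n are
-- checked one by one.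
⌈n/4⌉≤⌊n/3⌋ : ∀ n → 1 ≤ℕ n → n ≢ 1 → n ≢ 2 → n ≢ 5 → ⌈ n /4⌉ ≤ℕ n ℕ%./ 3
⌈n/4⌉≤⌊n/3⌋ 1 _ n≢1 _ _ = ⊥-elim (n≢1 refl)
⌈n/4⌉≤⌊n/3⌋ 2 _ _ n≢2 _ = ⊥-elim (n≢2 refl)
⌈n/4⌉≤⌊n/3⌋ 3 _ _ _ _ = s≤s z≤n
⌈n/4⌉≤⌊n/3⌋ 4 _ _ _ _ = s≤s z≤n
⌈n/4⌉≤⌊n/3⌋ 5 _ _ _ n≢5 = ⊥-elim (n≢5 refl)
⌈n/4⌉≤⌊n/3⌋ 6 _ _ _ _ = s≤s (s≤s z≤n)
⌈n/4⌉≤⌊n/3⌋ 7 _ _ _ _ = s≤s (s≤s z≤n)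
⌈n/4⌉≤⌊n/3⌋ 8 _ _ _ _ = s≤s (s≤s z≤n)
⌈n/4⌉≤⌊n/3⌋ n@(suc (suc (suc (suc (suc (suc (suc (suc (suc m))))))))) _ _ _ _ =
  subst (_≤ℕ n ℕ%./ 3) (ℕ%.m*n/n≡m c 3) (ℕ%./-monoˡ-≤ {c ℕ.* 3} {n} 3 (ℕₚ.*-cancelˡ-≤ {c ℕ.* 3} {n} 4 (begin
    4 ℕ.* (c ℕ.* 3)          ≡⟨ regroup c ⟩
    3 ℕ.* (c ℕ.* 4)          ≤⟨ ℕₚ.*-monoʳ-≤ 3 (ℕ%.m/n*n≤m (n ℕ.+ 3) 4) ⟩
    3 ℕ.* (n ℕ.+ 3)          ≡⟨ expand m ⟩
    36 ℕ.+ 3 ℕ.* m           ≤⟨ ℕₚ.+-monoʳ-≤ 36 (ℕₚ.*-monoˡ-≤ m (ℕₚ.n≤1+n 3)) ⟩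
    36 ℕ.+ 4 ℕ.* m           ≡⟨ ℕₚ.*-distribˡ-+ 4 9 m ⟨
    4 ℕ.* n                  ∎)))
  where
  open ℕₚ.≤-Reasoning
  c : ℕ
  c = ⌈ n /4⌉
  regroup : ∀ c → 4 ℕ.* (c ℕ.* 3) ≡ 3 ℕ.* (c ℕ.* 4)
  regroup = ℕ-Solver.solve-∀
  expand : ∀ m → 3 ℕ.* (9 ℕ.+ m ℕ.+ 3) ≡ 36 ℕ.+ 3 ℕ.* m
  expand = ℕ-Solver.solve-∀

÷-≥1 : ∀ {n k} → 1 ≤ℕ k → k ≤ℕ n → 1 ≤ℕ n ÷ k
÷-≥1 {k = suc _} _ k≤n = ℕ%.m≥n⇒m/n>0 k≤n

÷-<4 : ∀ {n k} → ⌈ n /4⌉ ℕ.< k → n ÷ k ℕ.< 4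
÷-<4 {n} {k@(suc _)} c<k = ℕ%.m<n*o⇒m/o<n (ℕₚ.<-≤-trans n<4k (ℕₚ.≤-reflexive (ℕₚ.*-comm k 4)))
  where
  n<4k : n ℕ.< k ℕ.* 4
  n<4k = ℕₚ.≰⇒> λ 4k≤n → ℕₚ.<⇒≱ c<k (subst (_≤ℕ ⌈ n /4⌉) (ℕ%.m*n/n≡m k 4) (ℕ%./-monoˡ-≤ 4 (ℕₚ.≤-trans 4k≤n (ℕₚ.m≤m+n n 3))))

÷-≥3 : ∀ {n k} → 1 ≤ℕ k → k ≤ℕ n ℕ%./ 3 → 3 ≤ℕ n ÷ k
÷-≥3 {n} {k@(suc _)} _ k≤ = subst (_≤ℕ n ℕ%./ k) (ℕ%.m*n/n≡m 3 k) (ℕ%./-monoˡ-≤ k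
  (ℕₚ.≤-trans (ℕₚ.≤-reflexive (ℕₚ.*-comm 3 k)) (ℕₚ.≤-trans (ℕₚ.*-monoˡ-≤ 3 k≤) (ℕ%.m/n*n≤m n 3))))

÷-<3 : ∀ {n k} → n ℕ%./ 3 ℕ.< k → n ÷ k ℕ.< 3
÷-<3 {n} {k@(suc _)} f<k = ℕ%.m<n*o⇒m/o<n (ℕₚ.<-≤-trans n<3k (ℕₚ.≤-reflexive (ℕₚ.*-comm k 3)))
  where
  n<3k : n ℕ.< k ℕ.* 3
  n<3k = ℕₚ.≰⇒> λ 3k≤n → ℕₚ.<⇒≱ f<k (subst (_≤ℕ n ℕ%./ 3) (ℕ%.m*n/n≡m k 3) (ℕ%./-monoˡ-≤ 3 3k≤n))

odd-1≤<4 : ∀ t → 1 ≤ℕ t → t ℕ.< 4 → odd⟦ (t ℕ.+ 3) ℕ%./ 4 ⟧ ≡ + 1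
odd-1≤<4 1 _ _ = refl
odd-1≤<4 2 _ _ = refl
odd-1≤<4 3 _ _ = refl
odd-1≤<4 (suc (suc (suc (suc _)))) _ (s≤s (s≤s (s≤s (s≤s ()))))

odd-3≤<4 : ∀ t → 3 ≤ℕ t → t ℕ.< 4 → odd⟦ (t ℕ.+ 1) ℕ%./ 4 ⟧ ≡ + 1
odd-3≤<4 1 (s≤s ()) _
odd-3≤<4 2 (s≤s (s≤s ())) _
odd-3≤<4 3 _ _ = refl
odd-3≤<4 (suc (suc (suc (suc _)))) _ (s≤s (s≤s (s≤s (s≤s ()))))

odd-<3 : ∀ t → t ℕ.< 3 → odd⟦ (t ℕ.+ 1) ℕ%./ 4 ⟧ ≡ + 0
odd-<3 0 _ = refl
odd-<3 1 _ = refl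
odd-<3 2 _ = refl
odd-<3 (suc (suc (suc _))) (s≤s (s≤s (s≤s ())))

∑-tail-const : ∀ m n f c → (∀ k → m ℕ.< k → k ≤ℕ m ℕ.+ n → f k ≡ c) → ∑ (m ℕ.+ n) f ≡ ∑ m f + + n * c
∑-tail-const m n f c f≡c = trans (∑-split m n f) (cong (_+_ (∑ m f))
  (trans (∑-cong n λ i 1≤i i≤n → f≡c (m ℕ.+ i) (ℕₚ.m<m+n m 1≤i) (ℕₚ.+-monoʳ-≤ m i≤n)) (∑-const n c)))

module _ (n : ℕ) (1≤n : 1 ≤ℕ n) (n≢1 : n ≢ 1) (n≢2 : n ≢ 2) (n≢5 : n ≢ 5) where
  private
    c f x y : ℕ
    c = ⌈ n /4⌉
    f = n ℕ%./ 3
    -- `x` counts the k with c < k ≤ f, where `n ÷ k` is 3, and `y` those with f < k ≤ n, where it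
    -- is 1 or 2.
    x = f ℕ.∸ c
    y = n ℕ.∸ f

    c+x≡f : c ℕ.+ x ≡ f
    c+x≡f = ℕₚ.m+[n∸m]≡n (⌈n/4⌉≤⌊n/3⌋ n 1≤n n≢1 n≢2 n≢5)

    f+y≡n : f ℕ.+ y ≡ n
    f+y≡n = ℕₚ.m+[n∸m]≡n (ℕ%.m/n≤m n 3)

    odd+3 odd+1 : ℕ → ℤ
    odd+3 k = odd⟦ (n ÷ k ℕ.+ 3) ℕ%./ 4 ⟧
    odd+1 k = odd⟦ (n ÷ k ℕ.+ 1) ℕ%./ 4 ⟧

    1≤ : ∀ {m k} → m ℕ.< k → 1 ≤ℕ k
    1≤ m<k = ℕₚ.≤-trans (s≤s z≤n) m<k

    c+x+y≡n : c ℕ.+ (x ℕ.+ y) ≡ n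
    c+x+y≡n = trans (sym (ℕₚ.+-assoc c x y)) (trans (cong (ℕ._+ y) c+x≡f) f+y≡n)

    ∑-odd+3 : ∑ n odd+3 ≡ ∑ c odd+3 + + (x ℕ.+ y) * + 1
    ∑-odd+3 = trans (cong (λ t → ∑ t odd+3) (sym c+x+y≡n)) (∑-tail-const c (x ℕ.+ y) odd+3 (+ 1) λ k c<k k≤ →
      odd-1≤<4 (n ÷ k) (÷-≥1 (1≤ c<k) (subst (k ≤ℕ_) c+x+y≡n k≤)) (÷-<4 {n} {k} c<k))

    ∑-odd+1 : ∑ n odd+1 ≡ ∑ c odd+1 + + x * + 1 + + y * + 0
    ∑-odd+1 = begin
      ∑ n odd+1                             ≡⟨ cong (λ t → ∑ t odd+1) f+y≡n ⟨
      ∑ (f ℕ.+ y) odd+1                     ≡⟨ ∑-tail-const f y odd+1 (+ 0) (λ k f<k _ → odd-<3 (n ÷ k) (÷-<3 {n} {k} f<k)) ⟩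
      ∑ f odd+1 + + y * + 0                 ≡⟨ cong (λ t → ∑ t odd+1 + + y * + 0) c+x≡f ⟨
      ∑ (c ℕ.+ x) odd+1 + + y * + 0         ≡⟨ cong (_+ + y * + 0) (∑-tail-const c x odd+1 (+ 1) λ k c<k k≤ →
                                                 odd-3≤<4 (n ÷ k) (÷-≥3 {n} {k} (1≤ c<k) (subst (k ≤ℕ_) c+x≡f k≤)) (÷-<4 {n} {k} c<k)) ⟩
      ∑ c odd+1 + + x * + 1 + + y * + 0     ∎
      where open ≡-Reasoning

  F≡𝒩 : + F n ≡ + 1
    + + 2 * ∑ ⌈ n /4⌉ (λ k → odd⟦ (n ÷ k ℕ.+ 3) ℕ%./ 4 ⟧)
    + + 2 * ∑ ⌈ n /4⌉ (λ k → odd⟦ (n ÷ k ℕ.+ 1) ℕ%./ 4 ⟧)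
    + + 2 * + n
    + + 2 * + (n ℕ%./ 3)
    - + 4 * + ⌈ n /4⌉
  F≡𝒩 = begin
    + F n                                                       ≡⟨ F≡∑g n ⟩
    + 1 + + 2 * ∑ n g                                           ≡⟨ cong (λ t → + 1 + + 2 * t) (trans (∑g≡∑∑χ n)
                                                                     (trans (∑-cong n λ k _ _ → ∑χ≡odd (n ÷ k)) (∑-+ n odd+3 odd+1))) ⟩
    + 1 + + 2 * (∑ n odd+3 + ∑ n odd+1)                         ≡⟨ cong₂ (λ s t → + 1 + + 2 * (s + t)) ∑-odd+3 ∑-odd+1 ⟩
    + 1 + + 2 * (∑ c odd+3 + + (x ℕ.+ y) * + 1 + (∑ c odd+1 + + x * + 1 + + y * + 0))
      -- With n = c + x + y and ⌊n/3⌋ = c + x, the tail (x + y) + x equals n + ⌊n/3⌋ - 2c.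
      ≡⟨ rearrange (∑ c odd+3) (∑ c odd+1) (+ c) (+ x) (+ y) ⟩
    + 1 + + 2 * ∑ c odd+3 + + 2 * ∑ c odd+1 + + 2 * + (c ℕ.+ (x ℕ.+ y)) + + 2 * + (c ℕ.+ x) - + 4 * + c
      ≡⟨ cong₂ (λ s t → + 1 + + 2 * ∑ c odd+3 + + 2 * ∑ c odd+1 + + 2 * + s + + 2 * + t - + 4 * + c) c+x+y≡n c+x≡f ⟩
    + 1 + + 2 * ∑ c odd+3 + + 2 * ∑ c odd+1 + + 2 * + n + + 2 * + f - + 4 * + c ∎
    where
    open ≡-Reasoning
    rearrange : ∀ a b c x y → + 1 + + 2 * (a + (x + y) * + 1 + (b + x * + 1 + y * + 0))
      ≡ + 1 + + 2 * a + + 2 * b + + 2 * (c + (x + y)) + + 2 * (c + x) - + 4 * c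
    rearrange = solve-∀

corollary5p10 : F 0 ≡ 1 × F 1 ≡ 3 × F 2 ≡ 5 × F 5 ≡ 11 ×
    (∀ (n : ℕ) → 1 ≤ℕ n → n ≢ 1 → n ≢ 2 → n ≢ 5 →
    + F n ≡ + 1
    + + 2 * (+ 𝒩 (∣ ceiling (+ n / 4) ∣) (+ 3 / 4) (frac ((- (+ n)) / 4)) (+ 1) 2)
    + + 2 * (+ 𝒩 (∣ ceiling (+ n / 4) ∣) (+ 1 / 4) (frac ((- (+ n)) / 4)) (+ 1) 2)
    + + 2 * + n
    + + 2 * floor (+ n / 3)
    - + 4 * ceiling (+ n / 4))
corollary5p10 = refl , refl , refl , refl , λ n 1≤n n≢1 n≢2 n≢5 →
  assemble n (sym (ceiling-/4 n)) (sym (𝒩≡∑ n 3)) (sym (𝒩≡∑ n 1)) (sym (floor-/ (+ n) 3)) (F≡𝒩 n 1≤n n≢1 n≢2 n≢5)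
  where
  -- Generalising the ceiling to a variable `z` lets one match replace it everywhere, including
  -- inside the first argument of `𝒩`, where ∣ z ∣ then reduces to ⌈n/4⌉.
  assemble : ∀ n {z s t f} → + ⌈ n /4⌉ ≡ z →
    s ≡ + 𝒩 ⌈ n /4⌉ (+ 3 / 4) (frac ((- (+ n)) / 4)) (+ 1) 2 →
    t ≡ + 𝒩 ⌈ n /4⌉ (+ 1 / 4) (frac ((- (+ n)) / 4)) (+ 1) 2 →
    + (n ℕ%./ 3) ≡ f →
    + F n ≡ + 1 + + 2 * s + + 2 * t + + 2 * + n + + 2 * + (n ℕ%./ 3) - + 4 * + ⌈ n /4⌉ →
    + F n ≡ + 1
      + + 2 * (+ 𝒩 (∣ z ∣) (+ 3 / 4) (frac ((- (+ n)) / 4)) (+ 1) 2)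
      + + 2 * (+ 𝒩 (∣ z ∣) (+ 1 / 4) (frac ((- (+ n)) / 4)) (+ 1) 2)
      + + 2 * + n + + 2 * f - + 4 * z
  assemble n refl refl refl refl eq = eq
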